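{- Let $m\ge 2$ be an integer, let $\gamma=1\,m\,(m-1)\cdots 2\in\mathcal S_m$ (that is, $1$ followed by $m,m-1,\dots,2$), and let $B=B(t,x)=\sum_{n\ge 0}t^n\sum_{\sigma\in\mathcal S_n(123)}x^{\gamma\text{ -mch}(\sigma)}$. Then $$B=\frac{1+(x-1)t^mB^m}{1-tB},$$ and for all integers $n\ge 0$, $k\ge 1$ the coefficient of $t^nx^k$ in $B$ is $$[t^nx^k]B=\frac{1}{k} \sum_{i=k}^{\lfloor n/m\rfloor} (-1)^{i-k} \binom{2n-mi}{n-mi,\;n+1-i,\;k-1,\;i-k}.$$
   Context: $\mathcal S_n$ is the set of permutations of $\{1,\dots,n\}$ in one-line notation ($\mathcal S_0$ contains only the empty permutation, on which all statistics are $0$). For a word $w$ of distinct integers, $\mathrm{red}(w)$ replaces the $i$-th smallest letter by $i$. $\sigma\in\mathcal S_n$ avoids $\lambda\in\mathcal S_k$ (classical avoidance) if no (not necessarily contiguous) subsequence $\sigma_{i_1}\cdots\sigma_{i_k}$, $i_1<\dots<i_k$, has reduction $\lambda$; $\mathcal S_n(\lambda)$ is the set of such $\sigma$. $\gamma\text{ -mch}(\sigma)$ is the number of $i$ with $\mathrm{red}(\sigma_i\sigma_{i+1}\cdots\sigma_{i+k-1})=\gamma$ for $\gamma\in\mathcal S_k$. The multinomial coefficient is $\binom{a}{b_1,b_2,b_3,b_4}=\frac{a!}{b_1!b_2!b_3!b_4!}$ with $b_1+b_2+b_3+b_4=a$. Identities are of formal power series in $t$ over $\mathbb Q[x]$.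 -}

module Defs where

open import Algebra.Bundles.Raw using (RawRing)
import Algebra.Definitions
import Algebra.Definitions.RawSemiring
open import Data.Fin.Base using (toℕ)
open import Data.Integer.Base using (+_)
open import Data.List.Base
  using (List; []; _∷_; length; map; foldr; filter; take; tails; applyUpTo;
         applyDownFrom; cartesianProductWith)
open import Data.List.Properties using (≡-dec)
open import Data.List.Relation.Binary.Sublist.Propositional
  using (_⊆_; []; _∷_; _∷ʳ_)
open import Data.List.Relation.Unary.Unique.DecPropositional using (unique?)
open import Data.Nat.Base as ℕ using (ℕ; zero; suc; _∸_; _!)
import Data.Nat.Properties as ℕ
open import Data.Product.Base using (∃-syntax; Σ-syntax; _×_; _,_; proj₁)
open import Data.Rational.Base as ℚ using (ℚ)
open import Function.Base using (_∘_)
open import Level using (_⊔_)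
open import Relation.Binary.PropositionalEquality.Core using (_≡_; refl)
open import Relation.Nullary.Decidable.Core using (map′; _⊎-dec_; ¬?)
open import Relation.Nullary.Negation.Core using (¬_)
open import Data.Sum.Base using (_⊎_; inj₁; inj₂; [_,_]′)
open import Relation.Unary using (Decidable)

Word : Set
Word = List ℕ

words : List ℕ → ℕ → List Word
words A zero    = [] ∷ []
words A (suc k) = cartesianProductWith _∷_ A (words A k)

-- The words of length n over {1, …, n} without repeated letters, each
-- listed once.
permutations : ℕ → List Word
permutations n = filter (unique? ℕ._≟_) (words (applyUpTo suc n) n)

-- For distinct letters, a is the i-th smallest letter of w exactly when
-- i letters of w are ≤ a.
red : Word → Word
red w = map (λ a → length (filter (ℕ._≤? a) w)) w

-- _⊆_ is the order-preserving (not necessarily contiguous) sublist relation.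
Contains : Word → Word → Set
Contains p σ = ∃[ τ ] (τ ⊆ σ × red τ ≡ p)

Avoids : Word → Word → Set
Avoids p σ = ¬ Contains p σ

anySublist? : ∀ {P : Word → Set} → Decidable P →
              Decidable (λ σ → ∃[ τ ] (τ ⊆ σ × P τ))
anySublist? P? [] = map′ (λ p → [] , [] , p) (λ { ([] , [] , p) → p }) (P? [])
anySublist? {P} P? (a ∷ σ) =
  map′ [ (λ (τ , s , p) → a ∷ τ , refl ∷ s , p) , (λ (τ , s , p) → τ , a ∷ʳ s , p) ]′
       split
       (anySublist? (P? ∘ (a ∷_)) σ ⊎-dec anySublist? P? σ)
  where
  split : ∃[ τ ] (τ ⊆ a ∷ σ × P τ) →
          ∃[ τ ] (τ ⊆ σ × P (a ∷ τ)) ⊎ ∃[ τ ] (τ ⊆ σ × P τ)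
  split (_ , refl ∷ s , p) = inj₁ (_ , s , p)
  split (_ , _ ∷ʳ s , p)   = inj₂ (_ , s , p)

avoids? : ∀ p → Decidable (Avoids p)
avoids? p σ = ¬? (anySublist? (λ τ → ≡-dec ℕ._≟_ (red τ) p) σ)

avoiding : ℕ → Word → List Word
avoiding n p = filter (avoids? p) (permutations n)

-- The number of consecutive occurrences of γ.  Windows cut short by the end
-- of σ do not contribute, because red preserves length.
mch : Word → Word → ℕ
mch γ σ = length (filter (λ w → ≡-dec ℕ._≟_ (red (take (length γ) w)) γ) (tails σ))

123-pattern : Word
123-pattern = 1 ∷ 2 ∷ 3 ∷ []

-- 1 m (m-1) ⋯ 2, for m ≥ 1
γ : ℕ → Word
γ m = 1 ∷ applyDownFrom (2 ℕ.+_) (m ∸ 1)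

module RingOps {c ℓ} (R : RawRing c ℓ) where
  open RawRing R
  open Algebra.Definitions _≈_ using (Invertible)
  open Algebra.Definitions.RawSemiring rawSemiring public using (_^_; sum)

  infixl 6 _-_
  _-_ : Carrier → Carrier → Carrier
  a - b = a + (- b)

  -- a equals the fraction b / d; in particular, d is a unit.
  infix 4 _≈_÷_
  _≈_÷_ : Carrier → Carrier → Carrier → Set (c ⊔ ℓ)
  a ≈ b ÷ d = Σ[ inverse ∈ Invertible 1# _*_ d ] a ≈ (b * proj₁ inverse)

  -- f a + f (a + 1) + ⋯ + f b, which is 0# when b < a
  ∑[_⋯_] : ℕ → ℕ → (ℕ → Carrier) → Carrier
  ∑[ a ⋯ b ] f = sum {suc b ∸ a} (λ j → f (a ℕ.+ toℕ j))

  ∑∈ : ∀ {A : Set} → List A → (A → Carrier) → Carrier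
  ∑∈ xs f = foldr _+_ 0# (map f xs)

-- Lists of coefficients, constant term first.  Equality
-- is coefficientwise, so trailing zeros are irrelevant.

module Polynomial {c ℓ} (R : RawRing c ℓ) where
  private module R = RawRing R

  Poly : Set c
  Poly = List R.Carrier

  coeff : Poly → ℕ → R.Carrier
  coeff []      _       = R.0#
  coeff (a ∷ p) zero    = a
  coeff (a ∷ p) (suc k) = coeff p k

  add : Poly → Poly → Poly
  add []      q       = q
  add (a ∷ p) []      = a ∷ p
  add (a ∷ p) (b ∷ q) = (a R.+ b) ∷ add p q

  mul : Poly → Poly → Poly
  mul []      q = []
  mul (a ∷ p) q = add (map (a R.*_) q) (R.0# ∷ mul p q)

  X : Poly
  X = R.0# ∷ R.1# ∷ []

  polynomialRing : RawRing c ℓ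
  polynomialRing = record
    { Carrier = Poly
    ; _≈_     = λ p q → ∀ k → coeff p k R.≈ coeff q k
    ; _+_     = add
    ; _*_     = mul
    ; -_      = map (R.-_)
    ; 0#      = []
    ; 1#      = R.1# ∷ []
    }

module PowerSeries {c ℓ} (R : RawRing c ℓ) where
  private module R = RawRing R
  open RingOps R using (∑[_⋯_])

  Series : Set c
  Series = ℕ → R.Carrier

  const : R.Carrier → Series
  const a zero    = a
  const a (suc n) = R.0#

  T : Series
  T zero          = R.0#
  T (suc zero)    = R.1#
  T (suc (suc n)) = R.0#

  seriesRing : RawRing c ℓ
  seriesRing = record
    { Carrier = Series
    ; _≈_     = λ f g → ∀ n → f n R.≈ g n
    ; _+_     = λ f g n → f n R.+ g n
    ; _*_     = λ f g n → ∑[ 0 ⋯ n ] (λ i → f i R.* g (n ∸ i))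
    ; -_      = λ f n → R.- f n
    ; 0#      = const R.0#
    ; 1#      = const R.1#
    }

ℚ-ring : RawRing _ _
ℚ-ring = ℚ.+-*-rawRing

open Polynomial ℚ-ring public using (Poly; coeff; X)

ℚ[x] : RawRing _ _
ℚ[x] = Polynomial.polynomialRing ℚ-ring

open PowerSeries ℚ[x] public using (Series; const)

ℚ[x]⟦t⟧ : RawRing _ _
ℚ[x]⟦t⟧ = PowerSeries.seriesRing ℚ[x]

x t : Series
x = const X
t = PowerSeries.T ℚ[x]

[t^_x^_]_ : ℕ → ℕ → Series → ℚ
[t^ n x^ k ] f = coeff (f n) k

B : ℕ → Series
B m n = ∑∈ (avoiding n 123-pattern) (λ σ → X ^ mch (γ m) σ)
  where open RingOps ℚ[x]

-- a! / (b₁! b₂! b₃! b₄!), to be used with a = b₁ + b₂ + b₃ + b₄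
multinomial : ℕ → ℕ → ℕ → ℕ → ℕ → ℚ
multinomial a b₁ b₂ b₃ b₄ = + (a !) ℚ./ (b₁ ! ℕ.* b₂ ! ℕ.* (b₃ ! ℕ.* b₄ !))
  where instance
  nonZero : ℕ.NonZero (b₁ ! ℕ.* b₂ ! ℕ.* (b₃ ! ℕ.* b₄ !))
  nonZero = ℕ.m*n≢0 _ _ {{b₁ ℕ.!* b₂ !≢0}} {{b₃ ℕ.!* b₄ !≢0}}

{-# OPTIONS --safe #-}
module Submission where

-- Read a 123-avoiding permutation from left to right.  Every letter is either
-- a new left-to-right minimum or the largest letter not yet read, so γ matches
-- exactly where a left-to-right minimum is followed by m − 1 letters that are
-- not minima.  Counting the words of letters that can still follow gives
-- [tⁿ] B = (Mⁿ w)(0), where M f = w · (f − f(0)) / u and w = Σ wₛ uˢ with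
-- wₛ = x if m ≤ s, and wₛ = 1 otherwise.  The map f ↦ Σ tⁿ (Mⁿ f)(0) turns out
-- to be multiplicative: it is the substitution u ↦ q, where q = t w(q).  Hence
-- B = w(q) and q = tB, and w = (1 + (x − 1) uᵐ) / (1 − u) gives the functional
-- equation.  The coefficients come from Lagrange inversion, that is
-- (n + 1) [tⁿ] B = [uⁿ] wⁿ⁺¹, which is proved by induction along M, and from the
-- binomial theorem.

open import Defs
import Algebra.Morphism.RingMonomorphism
import Algebra.Properties.CommutativeMonoid.Mult
import Algebra.Properties.CommutativeSemigroup
import Algebra.Properties.CommutativeSemiring.Binomial
import Algebra.Properties.CommutativeSemiring.Exp
import Algebra.Properties.Ring
import Algebra.Properties.Semiring.Exp
import Algebra.Properties.Semiring.Mult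
import Algebra.Properties.Semiring.Sum
open import Algebra.Bundles using (CommutativeRing)
open import Algebra.Bundles.Raw using (RawRing)
open import Algebra.Structures using (IsCommutativeRing)
open import Data.Bool.Base using (if_then_else_)
open import Data.Fin.Base using (Fin; toℕ; zero; suc)
open import Data.Fin.Properties using (toℕ<n)
open import Data.Integer.Base as ℤ using (+_)
import Data.Integer.Properties as ℤ
open import Data.List.Base
  using (List; []; _∷_; _++_; map; length; filter; take; takeWhile; tails; applyUpTo; applyDownFrom)
open import Data.List.Membership.Propositional using (_∈_)
open import Data.List.Membership.Propositional.Properties
open import Data.List.Membership.Propositional.Properties.WithK using (unique∧set⇒bag)
open import Data.List.Properties
  using (++-assoc; ∷-injective; ∷-injectiveˡ; ∷-injectiveʳ; length-++; length-map;
         length-applyDownFrom; filter-accept; filter-reject; filter-none; filter-all;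
         filter-some; map-cong-local; ≡-dec)
open import Data.List.Relation.Binary.BagAndSetEquality using (∼bag⇒↭)
open import Data.List.Relation.Binary.Permutation.Propositional
  using (_↭_; ↭-refl; ↭-sym; ↭-trans; ↭-reflexive; ↭⇒↭ₛ)
open import Data.List.Relation.Binary.Permutation.Propositional.Properties as ↭
  using (∈-resp-↭; drop-∷; drop-mid; ↭-empty-inv; ↭-length)
import Data.List.Relation.Binary.Permutation.Setoid.Properties as ↭ₛ
open import Data.List.Relation.Binary.Sublist.Propositional
  using (_⊆_; []; _∷_; _∷ʳ_; from∈; lookup; ⊆-trans)
open import Data.List.Relation.Binary.Sublist.Propositional.Properties using (take-⊆)
open import Data.List.Relation.Unary.All as All using (All; []; _∷_)
import Data.List.Relation.Unary.All.Properties as All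
open import Data.List.Relation.Unary.AllPairs as AllPairs using (AllPairs; []; _∷_)
import Data.List.Relation.Unary.AllPairs.Properties as AllPairs
open import Data.List.Relation.Unary.Any as Any using (here; there)
open import Data.List.Relation.Unary.Unique.DecPropositional using (unique?)
open import Data.List.Relation.Unary.Unique.Propositional using (Unique)
import Data.List.Relation.Unary.Unique.Propositional.Properties as Unique
open import Data.Nat.Base as ℕ
  using (ℕ; zero; suc; _≤_; _<_; _>_; _∸_; _!; NonZero; z≤n; s≤s)
open import Data.Nat.Combinatorics
  using (_C_; nCn≡1; nCk≡n!/k![n-k]!; nCk≡nC[n∸k]; k>n⇒nCk≡0;
         nCk+nC[k+1]≡[n+1]C[k+1]; k![n∸k]!∣n!)
import Data.Nat.DivMod as ℕ
import Data.Nat.Properties as ℕ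
open import Data.Nat.Tactic.RingSolver using (solve-∀)
import Data.Product.Base as Product
open Product using (∃-syntax; _,_; proj₂)
open import Data.Rational.Base as ℚ using (ℚ; 0ℚ; 1ℚ)
import Data.Rational.Properties as ℚ
open import Data.Rational.Unnormalised.Base as ℚᵘ using (mkℚᵘ; *≡*)
import Data.Rational.Unnormalised.Properties as ℚᵘ
open import Data.Sum.Base using (inj₁; inj₂)
open import Function.Base using (_∘_)
open import Function.Bundles using (mk⇔)
import Relation.Binary.PropositionalEquality as ≡
open ≡ using (_≡_; _≢_)
import Relation.Binary.Reasoning.Setoid
open import Relation.Nullary.Decidable using (does; yes; no; dec-true; dec-false)
open import Relation.Nullary.Negation.Core using (¬_; contradiction)

-- Why `M` is substitution: `q = t w(q)` gives `f(q) = f(0) + q ((f − f(0))/u)(q) = f(0) + t (M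
-- f)(q)`, and repeating this leaves `(Mⁿ f)(0)` as the coefficient of `tⁿ`. Taking these numbers as
-- the definition of `f(q)` settles existence and convergence at once; what has to be proved is that
-- the map respects products. Why `M` governs the permutations: if `d` unread letters lie below
-- everything read and `j` larger ones wait, the weighted count of continuations that start with a
-- new minimum depends only on `d` and `j`. When `d` grows by one, the additional letter is either
-- passed over, which turns `j` into `j + 1`, or read as the new minimum, followed by `r` waiting
-- letters and then the next minimum, with weight `w_(r+1)`. Since `w_0 = 1`, the first alternative
-- is the zeroth term of the convolution that the second one forms, and together they are one
-- application of `M`. The induction for Lagrange inversion yields its claim multiplied by `n`; this
-- is why positive integers must be cancelled, which is possible over `ℚ[x]`.

-- The commutative ring of formal power series.

module SeriesRing {c ℓ} (R : CommutativeRing c ℓ) where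
  open CommutativeRing R
  private module S = RawRing (PowerSeries.seriesRing rawRing)
  open S using () renaming (Carrier to Ser; _≈_ to _≋_; _*_ to _⊛_; _+_ to _⊕_)
  open Relation.Binary.Reasoning.Setoid setoid
  open Algebra.Properties.CommutativeSemigroup +-commutativeSemigroup
    using (interchange; x∙yz≈y∙xz)

  shift : Ser → Ser
  shift f n = f (suc n)

  -- (f ⊛ g) (suc n) unfolds to f 0 * g (suc n) + (shift f ⊛ g) n, so the ring
  -- laws are proved by induction on the exponent, for all series at once.
  *-cong-≋ : ∀ {f f′ g g′} → f ≋ f′ → g ≋ g′ → f ⊛ g ≋ f′ ⊛ g′
  *-cong-≋ p q zero    = +-congʳ (*-cong (p 0) (q 0))
  *-cong-≋ p q (suc n) = +-cong (*-cong (p 0) (q (suc n))) (*-cong-≋ (p ∘ suc) q n)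

  scaleˡ : ∀ a f g → (λ n → a * f n) ⊛ g ≋ (λ n → a * (f ⊛ g) n)
  scaleˡ a f g zero    = begin
    a * f 0 * g 0 + 0#    ≈⟨ +-cong (*-assoc _ _ _) (sym (zeroʳ a)) ⟩
    a * (f 0 * g 0) + a * 0# ≈⟨ distribˡ _ _ _ ⟨
    a * (f 0 * g 0 + 0#)  ∎
  scaleˡ a f g (suc n) = begin
    a * f 0 * g (suc n) + ((λ i → a * shift f i) ⊛ g) n
      ≈⟨ +-cong (*-assoc _ _ _) (scaleˡ a (shift f) g n) ⟩
    a * (f 0 * g (suc n)) + a * (shift f ⊛ g) n
      ≈⟨ distribˡ _ _ _ ⟨
    a * (f 0 * g (suc n) + (shift f ⊛ g) n) ∎

  *-distribʳ-≋ : ∀ h f g → (f ⊕ g) ⊛ h ≋ (f ⊛ h) ⊕ (g ⊛ h)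
  *-distribʳ-≋ h f g zero    = begin
    (f 0 + g 0) * h 0 + 0#            ≈⟨ +-cong (distribʳ _ _ _) (sym (+-identityʳ 0#)) ⟩
    (f 0 * h 0 + g 0 * h 0) + (0# + 0#) ≈⟨ interchange _ _ _ _ ⟩
    (f 0 * h 0 + 0#) + (g 0 * h 0 + 0#) ∎
  *-distribʳ-≋ h f g (suc n) = begin
    (f 0 + g 0) * h (suc n) + ((shift f ⊕ shift g) ⊛ h) n
      ≈⟨ +-cong (distribʳ _ _ _) (*-distribʳ-≋ h (shift f) (shift g) n) ⟩
    (f 0 * h (suc n) + g 0 * h (suc n)) + ((shift f ⊛ h) n + (shift g ⊛ h) n)
      ≈⟨ interchange _ _ _ _ ⟩
    (f ⊛ h) (suc n) + (g ⊛ h) (suc n) ∎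

  *-assoc-≋ : ∀ f g h → (f ⊛ g) ⊛ h ≋ f ⊛ (g ⊛ h)
  *-assoc-≋ f g h zero    = +-congʳ (begin
    (f 0 * g 0 + 0#) * h 0 ≈⟨ *-congʳ (+-identityʳ _) ⟩
    f 0 * g 0 * h 0        ≈⟨ *-assoc _ _ _ ⟩
    f 0 * (g 0 * h 0)      ≈⟨ *-congˡ (+-identityʳ _) ⟨
    f 0 * (g 0 * h 0 + 0#) ∎)
  *-assoc-≋ f g h (suc n) = begin
    (f 0 * g 0 + 0#) * h (suc n) + (shift (f ⊛ g) ⊛ h) n
      -- `shift (f ⊛ g)` unfolds to the sum of `f 0` times `shift g` and `shift f ⊛ g`, so
      -- distributivity applies to it directly.
      ≈⟨ +-cong (trans (*-congʳ (+-identityʳ _)) (*-assoc _ _ _))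
                (*-distribʳ-≋ h (λ i → f 0 * g (suc i)) (shift f ⊛ g) n) ⟩
    f 0 * (g 0 * h (suc n)) + (((λ i → f 0 * g (suc i)) ⊛ h) n + ((shift f ⊛ g) ⊛ h) n)
      ≈⟨ +-congˡ (+-cong (scaleˡ (f 0) (shift g) h n) (*-assoc-≋ (shift f) g h n)) ⟩
    f 0 * (g 0 * h (suc n)) + (f 0 * (shift g ⊛ h) n + (shift f ⊛ (g ⊛ h)) n)
      ≈⟨ +-assoc _ _ _ ⟨
    f 0 * (g 0 * h (suc n)) + f 0 * (shift g ⊛ h) n + (shift f ⊛ (g ⊛ h)) n
      ≈⟨ +-congʳ (distribˡ _ _ _) ⟨
    f 0 * (g ⊛ h) (suc n) + (shift f ⊛ (g ⊛ h)) n ∎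

  -- Mirror image of the definitional unfolding: the other end of the convolution is split off.
  -- Matching the two unfoldings gives commutativity by induction.
  *-unfoldʳ : ∀ f g n → (f ⊛ g) (suc n) ≈ f (suc n) * g 0 + (f ⊛ shift g) n
  *-unfoldʳ f g zero    = trans (+-congˡ (+-identityʳ _))
    (trans (+-comm _ _) (+-congˡ (sym (+-identityʳ _))))
  *-unfoldʳ f g (suc n) = begin
    f 0 * g (suc (suc n)) + (shift f ⊛ g) (suc n)
      ≈⟨ +-congˡ (*-unfoldʳ (shift f) g n) ⟩
    f 0 * g (suc (suc n)) + (f (suc (suc n)) * g 0 + (shift f ⊛ shift g) n)
      ≈⟨ x∙yz≈y∙xz _ _ _ ⟩
    f (suc (suc n)) * g 0 + (f ⊛ shift g) (suc n) ∎

  *-comm-≋ : ∀ f g → f ⊛ g ≋ g ⊛ f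
  *-comm-≋ f g zero    = +-congʳ (*-comm _ _)
  *-comm-≋ f g (suc n) = begin
    f 0 * g (suc n) + (shift f ⊛ g) n ≈⟨ +-cong (*-comm _ _) (*-comm-≋ (shift f) g n) ⟩
    g (suc n) * f 0 + (g ⊛ shift f) n ≈⟨ *-unfoldʳ g f n ⟨
    (g ⊛ f) (suc n)                   ∎

  zeroˡ-≋ : ∀ g → (λ _ → 0#) ⊛ g ≋ (λ _ → 0#)
  zeroˡ-≋ g zero    = trans (+-identityʳ _) (zeroˡ _)
  zeroˡ-≋ g (suc n) = trans (+-cong (zeroˡ _) (zeroˡ-≋ g n)) (+-identityʳ _)

  scaleʳ : ∀ a f g → f ⊛ (λ n → a * g n) ≋ (λ n → a * (f ⊛ g) n)
  scaleʳ a f g n = begin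
    (f ⊛ (λ i → a * g i)) n ≈⟨ *-comm-≋ f (λ i → a * g i) n ⟩
    ((λ i → a * g i) ⊛ f) n ≈⟨ scaleˡ a g f n ⟩
    a * (g ⊛ f) n           ≈⟨ *-congˡ (*-comm-≋ g f n) ⟩
    a * (f ⊛ g) n           ∎

  zeroʳ-≋ : ∀ f → f ⊛ (λ _ → 0#) ≋ (λ _ → 0#)
  zeroʳ-≋ f n = trans (*-comm-≋ f (λ _ → 0#) n) (zeroˡ-≋ f n)

  const-* : ∀ a g → PowerSeries.const rawRing a ⊛ g ≋ (λ n → a * g n)
  const-* a g zero    = +-identityʳ _
  const-* a g (suc n) = trans (+-congˡ (zeroˡ-≋ g n)) (+-identityʳ _)

  const-0 : PowerSeries.const rawRing 0# ≋ (λ _ → 0#)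
  const-0 zero    = refl
  const-0 (suc n) = refl

  isCommutativeRing-≋ :
    IsCommutativeRing S._≈_ S._+_ S._*_ S.-_ S.0# S.1#
  isCommutativeRing-≋ = record
    { isRing = record
      { +-isAbelianGroup = record
        { isGroup = record
          { isMonoid = record
            { isSemigroup = record
              { isMagma = record
                { isEquivalence = record
                  { refl  = λ n → refl
                  ; sym   = λ p n → sym (p n)
                  ; trans = λ p q n → trans (p n) (q n)
                  }
                ; ∙-cong = λ p q n → +-cong (p n) (q n)
                }
              ; assoc = λ f g h n → +-assoc (f n) (g n) (h n)
              }
            ; identity = (λ f n → trans (+-congʳ (const-0 n)) (+-identityˡ (f n)))
                       , (λ f n → trans (+-congˡ (const-0 n)) (+-identityʳ (f n)))
            }
          ; inverse = (λ f n → trans (-‿inverseˡ (f n)) (sym (const-0 n)))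
                    , (λ f n → trans (-‿inverseʳ (f n)) (sym (const-0 n)))
          ; ⁻¹-cong = λ p n → -‿cong (p n)
          }
        ; comm = λ f g n → +-comm (f n) (g n)
        }
      ; *-cong     = *-cong-≋
      ; *-assoc    = *-assoc-≋
      ; *-identity = identityˡ
                   , (λ f n → trans (*-comm-≋ f S.1# n) (identityˡ f n))
      ; distrib    = (λ h f g n → trans (*-comm-≋ h (f ⊕ g) n)
                       (trans (*-distribʳ-≋ h f g n)
                              (+-cong (*-comm-≋ f h n) (*-comm-≋ g h n))))
                   , *-distribʳ-≋
      }
    ; *-comm = *-comm-≋
    }
    where
    identityˡ : ∀ f → S.1# ⊛ f ≋ f
    identityˡ f n = trans (const-* 1# f n) (*-identityˡ (f n))

  seriesCommutativeRing : CommutativeRing c ℓ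
  seriesCommutativeRing = record { isCommutativeRing = isCommutativeRing-≋ }

-- Polynomials inside the ring of power series.

module PolynomialRing {c ℓ} (R : CommutativeRing c ℓ) where
  open CommutativeRing R
  private
    module S = CommutativeRing (SeriesRing.seriesCommutativeRing R)
    module P = Polynomial rawRing
    module Pₓ = RawRing P.polynomialRing
  open import Algebra.Properties.Ring ring using (-0#≈0#)

  coeff-+ : ∀ p q → P.coeff (P.add p q) S.≈ (P.coeff p S.+ P.coeff q)
  coeff-+ []      q       k       = sym (+-identityˡ _)
  coeff-+ (a ∷ p) []      k       = sym (+-identityʳ _)
  coeff-+ (a ∷ p) (b ∷ q) zero    = refl
  coeff-+ (a ∷ p) (b ∷ q) (suc k) = coeff-+ p q k

  coeff-scale : ∀ a q k → P.coeff (map (a *_) q) k ≈ a * P.coeff q k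
  coeff-scale a []      k       = sym (zeroʳ a)
  coeff-scale a (b ∷ q) zero    = refl
  coeff-scale a (b ∷ q) (suc k) = coeff-scale a q k

  coeff-* : ∀ p q → P.coeff (P.mul p q) S.≈ (P.coeff p S.* P.coeff q)
  coeff-* []      q k       = sym (SeriesRing.zeroˡ-≋ R (P.coeff q) k)
  coeff-* (a ∷ p) q zero    =
    trans (coeff-+ (map (a *_) q) _ 0) (+-congʳ (coeff-scale a q 0))
  coeff-* (a ∷ p) q (suc k) =
    trans (coeff-+ (map (a *_) q) _ (suc k))
          (+-cong (coeff-scale a q (suc k)) (coeff-* p q k))

  coeff-neg : ∀ p → P.coeff (map (-_) p) S.≈ (S.- P.coeff p)
  coeff-neg []      k       = sym -0#≈0#
  coeff-neg (a ∷ p) zero    = refl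
  coeff-neg (a ∷ p) (suc k) = coeff-neg p k

  coeff-1 : P.coeff Pₓ.1# S.≈ S.1#
  coeff-1 zero    = refl
  coeff-1 (suc k) = refl

  coeff-0 : P.coeff Pₓ.0# S.≈ S.0#
  coeff-0 zero    = refl
  coeff-0 (suc k) = refl

  -- Equality of polynomials is equality of their coefficient series, so `coeff` is injective by
  -- definition and all ring laws are pulled back along it.
  polynomialCommutativeRing : CommutativeRing c ℓ
  polynomialCommutativeRing = record
    { isCommutativeRing =
        Algebra.Morphism.RingMonomorphism.isCommutativeRing
          {R₁ = P.polynomialRing} {R₂ = S.rawRing} {⟦_⟧ = P.coeff}
          (record
            { isRingHomomorphism = record
              { isSemiringHomomorphism = record
                { isNearSemiringHomomorphism = record
                  { +-isMonoidHomomorphism = record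
                    { isMagmaHomomorphism = record
                      { isRelHomomorphism = record { cong = λ p → p }
                      ; homo = coeff-+
                      }
                    ; ε-homo = coeff-0
                    }
                  ; *-homo = coeff-*
                  }
                ; 1#-homo = coeff-1
                }
              ; -‿homo = coeff-neg
              }
            ; injective = λ p → p
            })
          S.isCommutativeRing
    }

-- The geometric series and substitution into power series.

module Composition {c ℓ} (R : CommutativeRing c ℓ) where
  open CommutativeRing R
  open SeriesRing R using (shift; scaleʳ; zeroʳ-≋; seriesCommutativeRing)
  module S = CommutativeRing seriesCommutativeRing
  open PowerSeries rawRing using (T) renaming (const to constant)
  open RingOps S.rawRing using () renaming (_^_ to _^ˢ_)
  open Algebra.Properties.Semiring.Mult semiring
  open Relation.Binary.Reasoning.Setoid setoid

  shift-T : shift T S.≈ S.1#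
  shift-T zero    = refl
  shift-T (suc n) = refl

  T-*-suc : ∀ f n → (T S.* f) (suc n) ≈ f n
  T-*-suc f n = begin
    0# * f (suc n) + (shift T S.* f) n ≈⟨ +-congʳ (zeroˡ _) ⟩
    0# + (shift T S.* f) n             ≈⟨ +-identityˡ _ ⟩
    (shift T S.* f) n                  ≈⟨ S.*-congʳ {f} shift-T n ⟩
    (S.1# S.* f) n                     ≈⟨ S.*-identityˡ f n ⟩
    f n                                ∎

  T-*-zero : ∀ f → (T S.* f) 0 ≈ 0#
  T-*-zero f = trans (+-identityʳ _) (zeroˡ _)

  T^-*-+ : ∀ k f n → (T ^ˢ k S.* f) (k ℕ.+ n) ≈ f n
  T^-*-+ zero    f n = S.*-identityˡ f n
  T^-*-+ (suc k) f n = begin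
    (T S.* T ^ˢ k S.* f) (suc (k ℕ.+ n))   ≈⟨ S.*-assoc T (T ^ˢ k) f (suc (k ℕ.+ n)) ⟩
    (T S.* (T ^ˢ k S.* f)) (suc (k ℕ.+ n)) ≈⟨ T-*-suc (T ^ˢ k S.* f) (k ℕ.+ n) ⟩
    (T ^ˢ k S.* f) (k ℕ.+ n)               ≈⟨ T^-*-+ k f n ⟩
    f n                                    ∎

  T^-*-< : ∀ k f {n} → n ℕ.< k → (T ^ˢ k S.* f) n ≈ 0#
  T^-*-< (suc k) f {zero}  _ = trans (S.*-assoc T (T ^ˢ k) f 0) (T-*-zero (T ^ˢ k S.* f))
  T^-*-< (suc k) f {suc n} (ℕ.s≤s n<k) = begin
    (T S.* T ^ˢ k S.* f) (suc n)   ≈⟨ S.*-assoc T (T ^ˢ k) f (suc n) ⟩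
    (T S.* (T ^ˢ k S.* f)) (suc n) ≈⟨ T-*-suc (T ^ˢ k S.* f) n ⟩
    (T ^ˢ k S.* f) n               ≈⟨ T^-*-< k f n<k ⟩
    0#                             ∎

  ones : S.Carrier
  ones _ = 1#

  ones-inverse : ones S.* (S.1# S.+ S.- T) S.≈ S.1#
  ones-inverse n = begin
    (ones S.* (S.1# S.+ S.- T)) n               ≈⟨ S.*-comm ones (S.1# S.+ S.- T) n ⟩
    ((S.1# S.+ S.- T) S.* ones) n               ≈⟨ S.distribʳ ones S.1# (S.- T) n ⟩
    (S.1# S.* ones) n + ((S.- T) S.* ones) n
      ≈⟨ +-cong (S.*-identityˡ ones n) (S.sym (-‿distribˡ-* T ones) n) ⟩
    1# + - (T S.* ones) n                       ≈⟨ telescope n ⟩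
    S.1# n                                      ∎
    where
    open import Algebra.Properties.Ring S.ring using (-‿distribˡ-*)
    open import Algebra.Properties.Ring ring using (-0#≈0#)
    telescope : ∀ n → 1# + - (T S.* ones) n ≈ S.1# n
    telescope zero    = trans (+-congˡ (trans (-‿cong (T-*-zero ones)) -0#≈0#)) (+-identityʳ _)
    telescope (suc n) = trans (+-congˡ (-‿cong (T-*-suc ones n))) (-‿inverseʳ 1#)

  -- Since `shift ones` is `ones`, the unfolding of the product expresses the coefficient for
  -- `(suc N, suc j)` as the sum of those for `(N, suc j)` and `(suc N, j)`, which is Pascal's rule.
  ones^-coefficient : ∀ N j → (ones ^ˢ suc N) j ≈ ((N ℕ.+ j) C N) × 1#
  ones^-coefficient zero j = trans (S.*-identityʳ ones j) (sym (+-identityʳ 1#))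
  ones^-coefficient (suc N) zero = begin
    1# * (ones ^ˢ suc N) 0 + 0#          ≈⟨ trans (+-identityʳ _) (*-identityˡ _) ⟩
    (ones ^ˢ suc N) 0                    ≈⟨ ones^-coefficient N 0 ⟩
    ((N ℕ.+ 0) C N) × 1#                 ≡⟨ ≡.cong (_× 1#) (≡.trans (diag N) (≡.sym (diag (suc N)))) ⟩
    ((suc N ℕ.+ 0) C suc N) × 1#         ∎
    where
    diag : ∀ N → (N ℕ.+ 0) C N ≡.≡ 1
    diag N = ≡.trans (≡.cong (_C N) (ℕ.+-identityʳ N)) (nCn≡1 N)
  ones^-coefficient (suc N) (suc j) = begin
    1# * (ones ^ˢ suc N) (suc j) + (ones ^ˢ suc (suc N)) j
      ≈⟨ +-cong (*-identityˡ _) (ones^-coefficient (suc N) j) ⟩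
    (ones ^ˢ suc N) (suc j) + ((suc N ℕ.+ j) C suc N) × 1#
      ≈⟨ +-congʳ (ones^-coefficient N (suc j)) ⟩
    ((N ℕ.+ suc j) C N) × 1# + ((suc N ℕ.+ j) C suc N) × 1#
      ≡⟨ ≡.cong (λ a → ((N ℕ.+ suc j) C N) × 1# + (a C suc N) × 1#) (≡.sym (ℕ.+-suc N j)) ⟩
    ((N ℕ.+ suc j) C N) × 1# + ((N ℕ.+ suc j) C suc N) × 1#
      ≈⟨ ×-homo-+ 1# ((N ℕ.+ suc j) C N) _ ⟨
    ((N ℕ.+ suc j) C N ℕ.+ (N ℕ.+ suc j) C suc N) × 1#
      ≡⟨ ≡.cong (_× 1#) (nCk+nC[k+1]≡[n+1]C[k+1] (N ℕ.+ suc j) N) ⟩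
    ((suc N ℕ.+ suc j) C suc N) × 1# ∎

  module _ (w : S.Carrier) where

    step : S.Carrier → S.Carrier
    step f = w S.* shift f

    steps : ℕ → S.Carrier → S.Carrier
    steps zero    f = f
    steps (suc n) f = steps n (step f)

    -- comp f is f(q), where q = comp T is the series with q = T · w(q).
    comp : S.Carrier → S.Carrier
    comp f n = steps n f 0

    step-cong : ∀ {f g} → f S.≈ g → step f S.≈ step g
    step-cong p = S.*-congˡ {w} (p ∘ suc)

    comp-cong : ∀ {f g} → f S.≈ g → comp f S.≈ comp g
    comp-cong p zero    = p 0
    comp-cong p (suc n) = comp-cong (step-cong p) n

    comp-+ : ∀ f g → comp (f S.+ g) S.≈ comp f S.+ comp g
    comp-+ f g zero    = refl
    comp-+ f g (suc n) = trans
      (comp-cong (S.distribˡ w (shift f) (shift g)) n) (comp-+ (step f) (step g) n)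

    comp-scale : ∀ a f n → comp (λ i → a * f i) n ≈ a * comp f n
    comp-scale a f zero    = refl
    comp-scale a f (suc n) =
      trans (comp-cong (scaleʳ a w (shift f)) n) (comp-scale a (step f) n)

    comp-neg : ∀ f → comp (S.- f) S.≈ S.- comp f
    comp-neg f n = begin
      comp (S.- f) n            ≈⟨ comp-cong (λ i → sym (-1*x≈-x (f i))) n ⟩
      comp (λ i → - 1# * f i) n ≈⟨ comp-scale (- 1#) f n ⟩
      - 1# * comp f n           ≈⟨ -1*x≈-x _ ⟩
      - comp f n                ∎
      where open import Algebra.Properties.Ring ring using (-1*x≈-x)

    comp-0 : comp (λ _ → 0#) S.≈ (λ _ → 0#)
    comp-0 zero    = refl
    comp-0 (suc n) = trans (comp-cong (zeroʳ-≋ w) n) (comp-0 n)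

    comp-const : ∀ a → comp (constant a) S.≈ constant a
    comp-const a zero    = refl
    comp-const a (suc n) = trans (comp-cong (zeroʳ-≋ w) n) (comp-0 n)

    -- `step` obeys a twisted product rule: `step (f g) = f(0) step g + (step f) g`. As
    -- `shift (comp f)` is `comp (step f)` by definition, the rule has exactly the shape of the
    -- unfolded product of `comp f` and `comp g`, and the induction closes.
    comp-* : ∀ f g → comp (f S.* g) S.≈ comp f S.* comp g
    comp-* f g zero    = refl
    comp-* f g (suc n) = begin
      comp (step (f S.* g)) n
        ≈⟨ comp-cong (λ i → trans (S.distribˡ w (λ k → f 0 * shift g k) (shift f S.* g) i)
             (+-cong (scaleʳ (f 0) w (shift g) i) (sym (S.*-assoc w (shift f) g i)))) n ⟩
      comp ((λ i → f 0 * step g i) S.+ (step f S.* g)) n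
        ≈⟨ comp-+ (λ i → f 0 * step g i) (step f S.* g) n ⟩
      comp (λ i → f 0 * step g i) n + comp (step f S.* g) n
        ≈⟨ +-cong (comp-scale (f 0) (step g) n) (comp-* (step f) g n) ⟩
      (comp f S.* comp g) (suc n) ∎

    comp-^ : ∀ f k → comp (f ^ˢ k) S.≈ comp f ^ˢ k
    comp-^ f zero    = comp-const 1#
    comp-^ f (suc k) = S.trans (comp-* f (f ^ˢ k)) (S.*-congˡ {comp f} (comp-^ f k))

    step-T : step T S.≈ w
    step-T = λ n → trans (S.*-congˡ {w} shift-T n) (S.*-identityʳ w n)

    comp-T : comp T S.≈ T S.* comp w
    comp-T zero    = sym (T-*-zero (comp w))
    comp-T (suc n) = trans (comp-cong step-T n) (sym (T-*-suc (comp w) n))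

-- Lagrange inversion.

module Derivation {c ℓ} (A : CommutativeRing c ℓ) where
  open CommutativeRing A
  open Algebra.Properties.Semiring.Mult semiring
  open Algebra.Properties.Semiring.Exp semiring using (_^_)
  open Algebra.Properties.CommutativeMonoid.Mult +-commutativeMonoid using (×-distrib-+)
  open Algebra.Properties.CommutativeSemigroup *-commutativeSemigroup
    using (x∙yz≈xz∙y)
  open Relation.Binary.Reasoning.Setoid setoid

  module _ (D : Carrier → Carrier)
           (D-cong : ∀ {f g} → f ≈ g → D f ≈ D g)
           (D-* : ∀ f g → D (f * g) ≈ D f * g + f * D g) where

    D-^ : ∀ w n → D (w ^ suc n) ≈ suc n × (w ^ n * D w)
    D-^ w zero    = begin
      D (w * 1#)              ≈⟨ D-cong (*-identityʳ w) ⟩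
      D w                     ≈⟨ *-identityˡ _ ⟨
      1# * D w                ≈⟨ +-identityʳ _ ⟨
      1# * D w + 0#           ∎
    D-^ w (suc n) = begin
      D (w * w ^ suc n)                                ≈⟨ D-* w (w ^ suc n) ⟩
      D w * w ^ suc n + w * D (w ^ suc n)              ≈⟨ +-cong (*-comm _ _) (*-congˡ (D-^ w n)) ⟩
      w ^ suc n * D w + w * (suc n × (w ^ n * D w))    ≈⟨ +-congˡ (×-comm-* (suc n) _ _) ⟩
      w ^ suc n * D w + suc n × (w * (w ^ n * D w))    ≈⟨ +-congˡ (×-congʳ (suc n) (*-assoc _ _ _)) ⟨
      w ^ suc n * D w + suc n × (w ^ suc n * D w)      ∎

    -- By Leibniz both sides are `suc n` times `(w D g + g D w) wⁿ`. The identity trades the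
    -- exponent `n` belonging to `step w f = w g` for the exponent `suc n` belonging to `f`, which
    -- is the induction step of Lagrange inversion.
    lagrange-step : ∀ w g n →
      n × (D g * w ^ suc n) + D (g * w ^ suc n) ≈ suc n × (D (w * g) * w ^ n)
    lagrange-step w g n = begin
      n × (D g * w ^ suc n) + D (g * w ^ suc n)
        ≈⟨ +-congˡ (D-* g (w ^ suc n)) ⟩
      n × (D g * w ^ suc n) + (D g * w ^ suc n + g * D (w ^ suc n))
        ≈⟨ +-assoc _ _ _ ⟨
      (n × (D g * w ^ suc n) + D g * w ^ suc n) + g * D (w ^ suc n)
        ≈⟨ +-cong (+-comm _ _) (*-congˡ (D-^ w n)) ⟩
      suc n × (D g * w ^ suc n) + g * (suc n × (w ^ n * D w))
        ≈⟨ +-congˡ (×-comm-* (suc n) _ _) ⟩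
      suc n × (D g * w ^ suc n) + suc n × (g * (w ^ n * D w))
        ≈⟨ ×-distrib-+ _ _ (suc n) ⟨
      suc n × (D g * (w * w ^ n) + g * (w ^ n * D w))
        ≈⟨ ×-congʳ (suc n) regroup ⟩
      suc n × (D (w * g) * w ^ n) ∎
      where
      regroup : D g * (w * w ^ n) + g * (w ^ n * D w) ≈ D (w * g) * w ^ n
      regroup = begin
        D g * (w * w ^ n) + g * (w ^ n * D w)
          ≈⟨ +-cong (trans (sym (*-assoc _ _ _)) (*-congʳ (*-comm _ _)))
                    (trans (x∙yz≈xz∙y g (w ^ n) (D w)) (*-congʳ (*-comm _ _))) ⟩
        w * D g * w ^ n + D w * g * w ^ n   ≈⟨ +-comm _ _ ⟩
        D w * g * w ^ n + w * D g * w ^ n   ≈⟨ distribʳ _ _ _ ⟨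
        (D w * g + w * D g) * w ^ n         ≈⟨ *-congʳ (D-* w g) ⟨
        D (w * g) * w ^ n                   ∎

module Lagrange {c ℓ} (R : CommutativeRing c ℓ) where
  open CommutativeRing R
  open SeriesRing R using (shift; seriesCommutativeRing)
  open Composition R
  open PowerSeries rawRing using (T)
  open RingOps S.rawRing using () renaming (_^_ to _^ˢ_)
  open Algebra.Properties.Semiring.Mult semiring
  open Algebra.Properties.CommutativeMonoid.Mult +-commutativeMonoid using (×-distrib-+)
  open Algebra.Properties.CommutativeSemigroup +-commutativeSemigroup
    using (x∙yz≈y∙xz)
  open Relation.Binary.Reasoning.Setoid setoid
  private module MS = Algebra.Properties.Semiring.Mult S.semiring

  ×-pointwise : ∀ m f n → (m MS.× f) n ≈ m × f n
  ×-pointwise zero    f zero    = refl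
  ×-pointwise zero    f (suc n) = refl
  ×-pointwise (suc m) f n       = +-congˡ (×-pointwise m f n)

  -- The Euler operator u·d/du.  Using it instead of d/du, Lagrange inversion
  -- n [tⁿ] f(q) = [uⁿ⁻¹] f′ wⁿ has no shifted index and also covers n = 0.
  θ : S.Carrier → S.Carrier
  θ f n = n × f n

  θ-cong : ∀ {f g} → f S.≈ g → θ f S.≈ θ g
  θ-cong p n = ×-congʳ n (p n)

  θ-* : ∀ f g → θ (f S.* g) S.≈ θ f S.* g S.+ f S.* θ g
  θ-* f g zero    = sym (begin
    (0# * g 0 + 0#) + (f 0 * 0# + 0#) ≈⟨ +-cong (+-identityʳ _) (+-identityʳ _) ⟩
    0# * g 0 + f 0 * 0#               ≈⟨ +-cong (zeroˡ _) (zeroʳ _) ⟩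
    0# + 0#                           ≈⟨ +-identityʳ _ ⟩
    0#                                ∎)
  θ-* f g (suc n) = begin
    suc n × (f 0 * g (suc n) + (shift f S.* g) n)
      ≈⟨ ×-distrib-+ _ _ (suc n) ⟩
    suc n × (f 0 * g (suc n)) + ((shift f S.* g) n + θ (shift f S.* g) n)
      ≈⟨ +-cong (sym (×-comm-* (suc n) _ _)) (+-congˡ (θ-* (shift f) g n)) ⟩
    f 0 * θ g (suc n) + ((shift f S.* g) n + ((θ (shift f) S.* g) n + (shift f S.* θ g) n))
      ≈⟨ +-congˡ (+-assoc _ _ _) ⟨
    f 0 * θ g (suc n) + (((shift f S.* g) n + (θ (shift f) S.* g) n) + (shift f S.* θ g) n)
      ≈⟨ x∙yz≈y∙xz _ _ _ ⟩
    ((shift f S.* g) n + (θ (shift f) S.* g) n) + (f S.* θ g) (suc n)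
      ≈⟨ +-congʳ (S.distribʳ g (shift f) (θ (shift f)) n) ⟨
    (shift (θ f) S.* g) n + (f S.* θ g) (suc n)
      ≈⟨ +-congʳ (trans (+-congʳ (zeroˡ _)) (+-identityˡ _)) ⟨
    (θ f S.* g) (suc n) + (f S.* θ g) (suc n) ∎

  θ-T : θ T S.≈ T
  θ-T zero          = refl
  θ-T (suc zero)    = +-identityʳ 1#
  θ-T (suc (suc n)) = ×-idem (+-identityʳ 0#) (suc (suc n))

  module _ (cancel : ∀ n {a b} → suc n × a ≈ suc n × b → a ≈ b) (w : S.Carrier) where

    -- Induction on `n` for all `f` at once, since `comp w f (suc n)` is `comp w (step w f) n`. With
    -- `g = shift f` one has `shift (θ f) = g + θ g`, and the constant term of `θ f` is zero, so the
    -- right side for `suc n` is the coefficient of `uⁿ` in `(g + θ g) wⁿ⁺¹`.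
    lagrange : ∀ f n → n × comp w f n ≈ (θ f S.* w ^ˢ n) n
    lagrange f zero          = sym (trans (+-identityʳ _) (zeroˡ _))
    -- The general step cancels the factor `n`, so the passage from 0 to 1 is checked directly.
    lagrange f (suc zero)    = begin
      (w 0 * f 1 + 0#) + 0#                             ≈⟨ +-identityʳ _ ⟩
      w 0 * f 1 + 0#                                    ≈⟨ +-congʳ (*-comm _ _) ⟩
      f 1 * w 0 + 0#                                    ≈⟨ +-congʳ (*-cong (+-identityʳ (f 1)) (S.*-identityʳ w 0)) ⟨
      (f 1 + 0#) * (w ^ˢ 1) 0 + 0#                      ≈⟨ trans (+-congʳ (zeroˡ _)) (+-identityˡ _) ⟨
      0# * (w ^ˢ 1) 1 + ((f 1 + 0#) * (w ^ˢ 1) 0 + 0#)  ∎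
    lagrange f (suc n@(suc k)) = cancel k (begin
      n × (suc n × comp w (step w f) n)
        ≈⟨ ×-assocˡ _ n (suc n) ⟩
      (n ℕ.* suc n) × comp w (step w f) n
        ≡⟨ ≡.cong (_× comp w (step w f) n) (ℕ.*-comm n (suc n)) ⟩
      (suc n ℕ.* n) × comp w (step w f) n
        ≈⟨ ×-assocˡ _ (suc n) n ⟨
      suc n × (n × comp w (step w f) n)
        ≈⟨ ×-congʳ (suc n) (lagrange (step w f) n) ⟩
      suc n × (θ (w S.* g) S.* w ^ˢ n) n
        ≈⟨ ×-pointwise (suc n) (θ (w S.* g) S.* w ^ˢ n) n ⟨
      (suc n MS.× (θ (w S.* g) S.* w ^ˢ n)) n
        -- At the exponent `n` the operator `θ` multiplies by `n`, so both summands obtained here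
        -- carry the factor that is to be cancelled.
        ≈⟨ Derivation.lagrange-step seriesCommutativeRing θ θ-cong θ-* w g n n ⟨
      (n MS.× (θ g S.* w ^ˢ suc n)) n + n × (g S.* w ^ˢ suc n) n
        ≈⟨ +-congʳ (×-pointwise n (θ g S.* w ^ˢ suc n) n) ⟩
      n × (θ g S.* w ^ˢ suc n) n + n × (g S.* w ^ˢ suc n) n
        ≈⟨ ×-distrib-+ _ _ n ⟨
      n × ((θ g S.* w ^ˢ suc n) n + (g S.* w ^ˢ suc n) n)
        ≈⟨ ×-congʳ n (+-comm _ _) ⟩
      n × ((g S.* w ^ˢ suc n) n + (θ g S.* w ^ˢ suc n) n)
        ≈⟨ ×-congʳ n (S.distribʳ (w ^ˢ suc n) g (θ g) n) ⟨
      n × (shift (θ f) S.* w ^ˢ suc n) n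
        ≈⟨ ×-congʳ n (trans (+-congʳ (zeroˡ _)) (+-identityˡ _)) ⟨
      n × (θ f S.* w ^ˢ suc n) (suc n) ∎)
      where g = shift f

    lagrange-T : ∀ n → suc n × comp w w n ≈ (w ^ˢ suc n) n
    lagrange-T n = begin
      suc n × comp w w n              ≈⟨ ×-congʳ (suc n) (comp-cong w (step-T w) n) ⟨
      suc n × comp w T (suc n)        ≈⟨ lagrange T (suc n) ⟩
      (θ T S.* w ^ˢ suc n) (suc n)    ≈⟨ S.*-congʳ {w ^ˢ suc n} θ-T (suc n) ⟩
      (T S.* w ^ˢ suc n) (suc n)      ≈⟨ T-*-suc (w ^ˢ suc n) n ⟩
      (w ^ˢ suc n) n                  ∎

-- The weight series: functional equation and coefficients of its powers.

module Weight {c ℓ} (R : CommutativeRing c ℓ) (m : ℕ) (a : CommutativeRing.Carrier R) where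
  open CommutativeRing R
  open SeriesRing R using (const-*)
  open Composition R
  open PowerSeries rawRing using (T) renaming (const to constant)
  open RingOps S.rawRing using (_≈_÷_) renaming (_^_ to _^ˢ_; _-_ to _-ˢ_; sum to sumˢ)
  open RingOps rawRing using (sum; _^_)
  open Algebra.Properties.Semiring.Mult semiring
  open Algebra.Properties.Semiring.Sum semiring using (sum-cong-≋; *-distribʳ-sum)
  private
    module MS = Algebra.Properties.Semiring.Mult S.semiring
    module ΣS = Algebra.Properties.Semiring.Sum S.semiring
    module ES = Algebra.Properties.Semiring.Exp S.semiring
    module CES = Algebra.Properties.CommutativeSemiring.Exp S.commutativeSemiring
    module Bin = Algebra.Properties.CommutativeSemiring.Binomial S.commutativeSemiring

  weight : S.Carrier
  weight s = if does (m ℕ.≤? s) then a else 1#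

  -- The factor `x − 1` in the form used by the functional equation, a difference of two series;
  -- `Y≈const` lets it act as a scalar.
  Y : S.Carrier
  Y = constant a -ˢ S.1#

  Y≈const : Y S.≈ constant (a - 1#)
  Y≈const zero    = refl
  Y≈const (suc n) = -‿inverseʳ 0#

  weight-factor : weight S.≈ (S.1# S.+ Y S.* T ^ˢ m) S.* ones
  weight-factor s = begin
    weight s                                       ≈⟨ split (m ℕ.≤? s) ⟩
    1# + (a - 1#) * (T ^ˢ m S.* ones) s            ≈⟨ +-congˡ (const-* (a - 1#) (T ^ˢ m S.* ones) s) ⟨
    1# + (constant (a - 1#) S.* (T ^ˢ m S.* ones)) s
      ≈⟨ +-congˡ (S.*-congʳ {T ^ˢ m S.* ones} Y≈const s) ⟨
    1# + (Y S.* (T ^ˢ m S.* ones)) s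
      ≈⟨ +-cong (S.*-identityˡ ones s) (S.*-assoc Y (T ^ˢ m) ones s) ⟨
    (S.1# S.* ones) s + (Y S.* T ^ˢ m S.* ones) s
      ≈⟨ S.distribʳ ones S.1# (Y S.* T ^ˢ m) s ⟨
    ((S.1# S.+ Y S.* T ^ˢ m) S.* ones) s           ∎
    where
    open Relation.Binary.Reasoning.Setoid setoid
    split : (d : _) → (if does d then a else 1#) ≈ 1# + (a - 1#) * (T ^ˢ m S.* ones) s
    split (yes m≤s) = sym (begin
      1# + (a - 1#) * (T ^ˢ m S.* ones) s
        ≡⟨ ≡.cong (λ k → 1# + (a - 1#) * (T ^ˢ m S.* ones) k) (ℕ.m+[n∸m]≡n m≤s) ⟨
      1# + (a - 1#) * (T ^ˢ m S.* ones) (m ℕ.+ (s ∸ m))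
        ≈⟨ +-congˡ (*-congˡ (T^-*-+ m ones (s ∸ m))) ⟩
      1# + (a - 1#) * 1#  ≈⟨ +-congˡ (*-identityʳ _) ⟩
      1# + (a - 1#)       ≈⟨ +-comm _ _ ⟩
      a - 1# + 1#         ≈⟨ +-assoc _ _ _ ⟩
      a + (- 1# + 1#)     ≈⟨ +-congˡ (-‿inverseˡ 1#) ⟩
      a + 0#              ≈⟨ +-identityʳ a ⟩
      a                   ∎)
    split (no m≰s) = sym (begin
      1# + (a - 1#) * (T ^ˢ m S.* ones) s
        ≈⟨ +-congˡ (trans (*-congˡ (T^-*-< m ones (ℕ.≰⇒> m≰s))) (zeroʳ _)) ⟩
      1# + 0# ≈⟨ +-identityʳ 1# ⟩
      1#      ∎)

  b : S.Carrier
  b = comp weight weight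

  comp-Y : comp weight Y S.≈ Y
  comp-Y n = trans (comp-cong weight Y≈const n)
    (trans (comp-const weight (a - 1#) n) (sym (Y≈const n)))

  -- Substituting `q` into `w = (1 + Y uᵐ) · ones` gives the numerator times `ones(q)`. The same
  -- substitution turns `ones · (1 − u) = 1` into the statement that `ones(q)` inverts `1 − t f`, so
  -- the unit required by the fraction is found along the way. The equation is stated for any `f`
  -- equal to `b` because `B` agrees with `b` only coefficient by coefficient.
  functionalEquation : ∀ {f} → f S.≈ b →
    f ≈ S.1# S.+ Y S.* T ^ˢ m S.* f ^ˢ m ÷ (S.1# -ˢ T S.* f)
  functionalEquation {f} f≈b = (inv , inverseˡ , inverseʳ) , (begin
    f                                                 ≈⟨ f≈b ⟩
    b                                                 ≈⟨ comp-cong weight weight-factor ⟩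
    comp weight ((S.1# S.+ Y S.* T ^ˢ m) S.* ones)
      ≈⟨ comp-* weight (S.1# S.+ Y S.* T ^ˢ m) ones ⟩
    comp weight (S.1# S.+ Y S.* T ^ˢ m) S.* inv       ≈⟨ S.*-congʳ {inv} numerator ⟩
    (S.1# S.+ Y S.* T ^ˢ m S.* f ^ˢ m) S.* inv        ∎)
    where
    open Relation.Binary.Reasoning.Setoid S.setoid
    inv : S.Carrier
    inv = comp weight ones
    T*f≈ : T S.* f S.≈ comp weight T
    T*f≈ = begin
      T S.* f          ≈⟨ S.*-congˡ {T} f≈b ⟩
      T S.* b          ≈⟨ comp-T weight ⟨
      comp weight T    ∎
    denominator : S.1# -ˢ T S.* f S.≈ comp weight (S.1# -ˢ T)
    denominator = begin
      S.1# -ˢ T S.* f                            ≈⟨ S.+-cong (S.sym (comp-const weight 1#)) (S.-‿cong T*f≈) ⟩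
      comp weight S.1# -ˢ comp weight T          ≈⟨ S.+-congˡ {comp weight S.1#} (comp-neg weight T) ⟨
      comp weight S.1# S.+ comp weight (S.- T)   ≈⟨ comp-+ weight S.1# (S.- T) ⟨
      comp weight (S.1# -ˢ T)                    ∎
    inverseˡ : inv S.* (S.1# -ˢ T S.* f) S.≈ S.1#
    inverseˡ = begin
      inv S.* (S.1# -ˢ T S.* f)                  ≈⟨ S.*-congˡ {inv} denominator ⟩
      inv S.* comp weight (S.1# -ˢ T)            ≈⟨ comp-* weight ones (S.1# -ˢ T) ⟨
      comp weight (ones S.* (S.1# -ˢ T))         ≈⟨ comp-cong weight ones-inverse ⟩
      comp weight S.1#                           ≈⟨ comp-const weight 1# ⟩
      S.1#                                       ∎
    inverseʳ : (S.1# -ˢ T S.* f) S.* inv S.≈ S.1#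
    inverseʳ = S.trans (S.*-comm (S.1# -ˢ T S.* f) inv) inverseˡ
    [T*f]^m : comp weight (T ^ˢ m) S.≈ T ^ˢ m S.* f ^ˢ m
    [T*f]^m = begin
      comp weight (T ^ˢ m)    ≈⟨ comp-^ weight T m ⟩
      comp weight T ^ˢ m      ≈⟨ ES.^-congˡ m T*f≈ ⟨
      (T S.* f) ^ˢ m          ≈⟨ CES.^-distrib-* T f m ⟩
      T ^ˢ m S.* f ^ˢ m       ∎
    numerator : comp weight (S.1# S.+ Y S.* T ^ˢ m) S.≈ S.1# S.+ Y S.* T ^ˢ m S.* f ^ˢ m
    numerator = begin
      comp weight (S.1# S.+ Y S.* T ^ˢ m)
        ≈⟨ comp-+ weight S.1# (Y S.* T ^ˢ m) ⟩
      comp weight S.1# S.+ comp weight (Y S.* T ^ˢ m)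
        ≈⟨ S.+-cong (comp-const weight 1#) (comp-* weight Y (T ^ˢ m)) ⟩
      S.1# S.+ comp weight Y S.* comp weight (T ^ˢ m)
        ≈⟨ S.+-congˡ {S.1#} (S.*-cong comp-Y [T*f]^m) ⟩
      S.1# S.+ Y S.* (T ^ˢ m S.* f ^ˢ m)
        ≈⟨ S.+-congˡ {S.1#} (S.*-assoc Y (T ^ˢ m) (f ^ˢ m)) ⟨
      S.1# S.+ Y S.* T ^ˢ m S.* f ^ˢ m ∎

  sum-pointwise : ∀ {k} (F : Fin k → S.Carrier) n → sumˢ F n ≈ sum (λ i → F i n)
  sum-pointwise {zero}  F zero    = refl
  sum-pointwise {zero}  F (suc n) = refl
  sum-pointwise {suc k} F n       = +-congˡ (sum-pointwise (λ i → F (suc i)) n)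

  const-^ : ∀ u i → constant u ^ˢ i S.≈ constant (u ^ i)
  const-^ u zero    = S.refl
  const-^ u (suc i) n = trans (S.*-congˡ {constant u} (const-^ u i) n)
    (trans (const-* u (constant (u ^ i)) n) (at n))
    where
    at : ∀ n → u * constant (u ^ i) n ≈ constant (u * u ^ i) n
    at zero    = refl
    at (suc n) = zeroʳ u

  1^ˢ : ∀ k → S.1# ^ˢ k S.≈ S.1#
  1^ˢ zero    = S.refl
  1^ˢ (suc k) = S.trans (S.*-identityˡ (S.1# ^ˢ k)) (1^ˢ k)

  weight^-coefficient : ∀ N n → (weight ^ˢ N) n ≈
    sum {suc N} (λ i → (N C toℕ i) × ((a - 1#) ^ toℕ i * (T ^ˢ (m ℕ.* toℕ i) S.* ones ^ˢ N) n))
  weight^-coefficient N n = begin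
    (weight ^ˢ N) n
      ≈⟨ ES.^-congˡ N weight-factor n ⟩
    (((S.1# S.+ Y S.* T ^ˢ m) S.* ones) ^ˢ N) n
      ≈⟨ CES.^-distrib-* (S.1# S.+ Y S.* T ^ˢ m) ones N n ⟩
    ((S.1# S.+ Y S.* T ^ˢ m) ^ˢ N S.* ones ^ˢ N) n
      -- The binomial theorem gives the summation index as exponent to the first summand, hence the
      -- exchange of the two summands.
      ≈⟨ S.*-congʳ {ones ^ˢ N} (S.trans (ES.^-congˡ N (S.+-comm S.1# (Y S.* T ^ˢ m)))
           (Bin.theorem N (Y S.* T ^ˢ m) S.1#)) n ⟩
    (sumˢ {suc N} E S.* ones ^ˢ N) n
      ≈⟨ ΣS.*-distribʳ-sum {suc N} (ones ^ˢ N) E n ⟩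
    sumˢ {suc N} (λ i → E i S.* ones ^ˢ N) n
      ≈⟨ sum-pointwise {suc N} (λ i → E i S.* ones ^ˢ N) n ⟩
    sum {suc N} (λ i → (E i S.* ones ^ˢ N) n)
      ≈⟨ sum-cong-≋ {suc N} (λ i → term (N C toℕ i) (toℕ i) (N ∸ toℕ i)) ⟩
    sum {suc N} (λ i → (N C toℕ i) × ((a - 1#) ^ toℕ i * (T ^ˢ (m ℕ.* toℕ i) S.* ones ^ˢ N) n)) ∎
    where
    open Relation.Binary.Reasoning.Setoid setoid
    E : Fin (suc N) → S.Carrier
    E i = (N C toℕ i) MS.× ((Y S.* T ^ˢ m) ^ˢ toℕ i S.* S.1# ^ˢ (N ∸ toℕ i))
    power : ∀ i k → (Y S.* T ^ˢ m) ^ˢ i S.* S.1# ^ˢ k S.≈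
                    constant ((a - 1#) ^ i) S.* T ^ˢ (m ℕ.* i)
    power i k = S.trans (S.*-congˡ {(Y S.* T ^ˢ m) ^ˢ i} (1^ˢ k))
      (S.trans (S.*-identityʳ ((Y S.* T ^ˢ m) ^ˢ i))
      (S.trans (CES.^-distrib-* Y (T ^ˢ m) i)
               (S.*-cong (S.trans (ES.^-congˡ i Y≈const) (const-^ (a - 1#) i)) (ES.^-assocʳ T m i))))
    term : ∀ e i k → (e MS.× ((Y S.* T ^ˢ m) ^ˢ i S.* S.1# ^ˢ k) S.* ones ^ˢ N) n ≈
                     e × ((a - 1#) ^ i * (T ^ˢ (m ℕ.* i) S.* ones ^ˢ N) n)
    term e i k = begin
      (e MS.× ((Y S.* T ^ˢ m) ^ˢ i S.* S.1# ^ˢ k) S.* ones ^ˢ N) n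
        ≈⟨ MS.×-assoc-* e ((Y S.* T ^ˢ m) ^ˢ i S.* S.1# ^ˢ k) (ones ^ˢ N) n ⟩
      (e MS.× ((Y S.* T ^ˢ m) ^ˢ i S.* S.1# ^ˢ k S.* ones ^ˢ N)) n
        ≈⟨ Lagrange.×-pointwise R e ((Y S.* T ^ˢ m) ^ˢ i S.* S.1# ^ˢ k S.* ones ^ˢ N) n ⟩
      e × ((Y S.* T ^ˢ m) ^ˢ i S.* S.1# ^ˢ k S.* ones ^ˢ N) n
        ≈⟨ ×-congʳ e (S.*-congʳ {ones ^ˢ N} (power i k) n) ⟩
      e × (constant ((a - 1#) ^ i) S.* T ^ˢ (m ℕ.* i) S.* ones ^ˢ N) n
        ≈⟨ ×-congʳ e (S.*-assoc (constant ((a - 1#) ^ i)) (T ^ˢ (m ℕ.* i)) (ones ^ˢ N) n) ⟩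
      e × (constant ((a - 1#) ^ i) S.* (T ^ˢ (m ℕ.* i) S.* ones ^ˢ N)) n
        ≈⟨ ×-congʳ e (const-* ((a - 1#) ^ i) (T ^ˢ (m ℕ.* i) S.* ones ^ˢ N) n) ⟩
      e × ((a - 1#) ^ i * (T ^ˢ (m ℕ.* i) S.* ones ^ˢ N) n) ∎

-- Generation of the 123-avoiding permutations by states.

module Continuations where
  open Product using (_×_)
  open ≡ using (refl; sym; trans; cong; cong₂; subst; setoid)

  down : ℕ → List ℕ
  down = applyDownFrom suc

  ∈-down⁻ : ∀ {d a} → a ∈ down d → a ≤ d
  ∈-down⁻ a∈ with _ , i<d , refl ← ∈-applyDownFrom⁻ suc a∈ = i<d

  -- The state of a 123-avoiding permutation read from left to right: the letters
  -- still to come are 1, …, d, which lie below all letters read, and those of E,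
  -- which have to come in decreasing order.  newMin lists the continuations that
  -- start with a letter ≤ d; all letters between it and d + 1 move to E.
  mutual
    newMin : ℕ → List ℕ → List Word
    newMin zero    E = []
    newMin (suc d) E = newMin d (E ++ suc d ∷ []) ++ map (suc d ∷_) (cont d E)

    cont : ℕ → List ℕ → List Word
    cont d E = newMin d E ++ nonMin d E

    nonMin : ℕ → List ℕ → List Word
    nonMin zero    []      = [] ∷ []
    -- Letters remain, but each of them would be a new minimum.
    nonMin (suc d) []      = []
    nonMin d       (e ∷ E) = map (e ∷_) (cont d E)

  State : ℕ → List ℕ → Set
  State d E = AllPairs _>_ E × All (d <_) E

  state-newMin : ∀ {d E} → State (suc d) E → State d (E ++ suc d ∷ [])
  state-newMin {d} (desc , large) =
    AllPairs.++⁺ desc ([] ∷ []) (All.map (_∷ []) large) ,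
    All.++⁺ (All.map ℕ.<⇒≤ large) (ℕ.≤-refl ∷ [])

  state-skip : ∀ {d E} → State (suc d) E → State d E
  state-skip (desc , large) = desc , All.map ℕ.<⇒≤ large

  state-tail : ∀ {d e E} → State d (e ∷ E) → State d E
  state-tail (_ ∷ desc , _ ∷ large) = desc , large

  -- The first waiting letter is the largest letter left. Reading it therefore starts neither a rise
  -- nor a match of `γ`.
  state-head : ∀ {d e E a} → State d (e ∷ E) → a ∈ E ++ down d → a < e
  state-head {E = E} (big ∷ _ , d<e ∷ _) a∈ with ∈-++⁻ E a∈
  ... | inj₁ a∈E = All.lookup big a∈E
  ... | inj₂ a∈d = ℕ.≤-<-trans (∈-down⁻ a∈d) d<e

  state-≢ : ∀ {d E a} → State (suc d) E → a ∈ E ++ down d → a ≢ suc d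
  state-≢ {E = E} (_ , large) a∈ refl with ∈-++⁻ E a∈
  ... | inj₁ a∈E = ℕ.<-irrefl refl (All.lookup large a∈E)
  ... | inj₂ a∈d = ℕ.<-irrefl refl (∈-down⁻ a∈d)

  state-unique : ∀ {d E} → State d E → Unique (E ++ down d)
  state-unique {d} {E} (desc , large) =
    Unique.++⁺ (AllPairs.map (λ x>y x≡y → ℕ.<-irrefl (sym x≡y) x>y) desc)
      (Unique.applyDownFrom⁺₁ suc d λ j<i _ → ℕ.<⇒≢ (s≤s j<i) ∘ sym)
      λ (a∈E , a∈d) → ℕ.<⇒≱ (All.lookup large a∈E) (∈-down⁻ a∈d)

  No123 : Word → Set
  No123 w = ∀ {a b c} → a ∷ b ∷ c ∷ [] ⊆ w → a < b → ¬ b < c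

  -- Given `perm`, a letter above `d` is a waiting letter. Waiting letters lie above a left-to-right
  -- minimum that precedes them, so a rise starting at one of them would complete a 123; `noRise`
  -- records this without mentioning the prefix already read.
  record Continuation (d : ℕ) (E : List ℕ) (w : Word) : Set where
    constructor continuation
    field
      perm   : w ↭ E ++ down d
      no123  : No123 w
      noRise : ∀ {a c} → a ∷ c ∷ [] ⊆ w → d < a → ¬ a < c
  open Continuation

  ++-assoc-down : ∀ d E → (E ++ suc d ∷ []) ++ down d ≡ E ++ down (suc d)
  ++-assoc-down d E = ++-assoc E (suc d ∷ []) (down d)

  mutual
    newMin-sound : ∀ d E {w} → State d E → w ∈ newMin d E → Continuation d E w
    newMin-sound (suc d) E st w∈ with ∈-++⁻ (newMin d (E ++ suc d ∷ [])) w∈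
    ... | inj₁ w∈ˡ = continuation
      (↭-trans (perm κ) (↭-reflexive (++-assoc-down d E)))
      (no123 κ)
      (λ s d<a → noRise κ s (ℕ.<⇒≤ d<a))
      where κ = newMin-sound d _ (state-newMin st) w∈ˡ
    ... | inj₂ w∈ʳ with w , w∈ , refl ← ∈-map⁻ (suc d ∷_) w∈ʳ = continuation
      (↭-trans (_↭_.prep _ (perm κ)) (↭-sym (↭.shift _ E (down d))))
      (λ { (refl ∷ s) d<b → noRise κ s (ℕ.<⇒≤ d<b) ; (_ ∷ʳ s) → no123 κ s })
      (λ { (refl ∷ s) d<d → contradiction d<d (ℕ.<-irrefl refl)
         ; (_ ∷ʳ s) d<a → noRise κ s (ℕ.<⇒≤ d<a) })
      where κ = cont-sound d E (state-skip st) w∈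

    cont-sound : ∀ d E {w} → State d E → w ∈ cont d E → Continuation d E w
    cont-sound d E st w∈ with ∈-++⁻ (newMin d E) w∈
    ... | inj₁ w∈ˡ = newMin-sound d E st w∈ˡ
    ... | inj₂ w∈ʳ = nonMin-sound d E st w∈ʳ

    nonMin-sound : ∀ d E {w} → State d E → w ∈ nonMin d E → Continuation d E w
    nonMin-sound zero [] st (here refl) = continuation ↭-refl (λ ()) (λ ())
    nonMin-sound d (e ∷ E) st w∈ with w , w∈ , refl ← ∈-map⁻ (e ∷_) (nonMin-∷ d w∈) = continuation
      (_↭_.prep e (perm κ))
      (λ { (refl ∷ s) e<b → contradiction e<b (ℕ.<-asym (smaller s)) ; (_ ∷ʳ s) → no123 κ s })
      (λ { (refl ∷ s) _ e<c → contradiction e<c (ℕ.<-asym (smaller s)) ; (_ ∷ʳ s) → noRise κ s })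
      where
      κ = cont-sound d E (state-tail st) w∈
      smaller : ∀ {a u} → a ∷ u ⊆ w → a < e
      smaller s = state-head st (∈-resp-↭ (perm κ) (lookup s (here refl)))

    nonMin-∷ : ∀ d {e E w} → w ∈ nonMin d (e ∷ E) → w ∈ map (e ∷_) (cont d E)
    nonMin-∷ zero    w∈ = w∈
    nonMin-∷ (suc d) w∈ = w∈

  nonMin-∷⁺ : ∀ d {e E w} → w ∈ cont d E → e ∷ w ∈ nonMin d (e ∷ E)
  nonMin-∷⁺ zero    = ∈-map⁺ (_ ∷_)
  nonMin-∷⁺ (suc d) = ∈-map⁺ (_ ∷_)

  mutual
    -- The first letter `b` supplies the small letter in front of any later rise, so `noRise` for
    -- the rest of the word follows from `No123 (b ∷ w)`.
    newMin-complete : ∀ d E {b w} → State d E → b ∈ down d → b ∷ w ↭ E ++ down d →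
                      No123 (b ∷ w) → b ∷ w ∈ newMin d E
    newMin-complete (suc d) E st (there b∈) p av =
      ∈-++⁺ˡ (newMin-complete d _ (state-newMin st) b∈
        (↭-trans p (↭-reflexive (sym (++-assoc-down d E)))) av)
    newMin-complete (suc d) E {w = w} st (here refl) p av =
      ∈-++⁺ʳ (newMin d (E ++ suc d ∷ [])) (∈-map⁺ (suc d ∷_)
        (cont-complete d E (state-skip st) (continuation q (av ∘ (_ ∷ʳ_)) rise)))
      where
      q : w ↭ E ++ down d
      q = drop-mid [] E p
      rise : ∀ {a c} → a ∷ c ∷ [] ⊆ w → d < a → ¬ a < c
      rise s d<a = av (refl ∷ s)
        (ℕ.≤∧≢⇒< d<a (state-≢ st (∈-resp-↭ q (lookup s (here refl))) ∘ sym))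

    cont-complete : ∀ d E {w} → State d E → Continuation d E w → w ∈ cont d E
    cont-complete d       (e ∷ E) {[]} st κ with () ← ↭-empty-inv (↭-sym (perm κ))
    cont-complete (suc d) []      {[]} st κ with () ← ↭-empty-inv (↭-sym (perm κ))
    cont-complete zero    []      {[]} st κ = here refl
    cont-complete d E {b ∷ w} st κ with ∈-++⁻ E (∈-resp-↭ (perm κ) (here refl))
    ... | inj₂ b∈d = ∈-++⁺ˡ (newMin-complete d E st b∈d (perm κ) (no123 κ))
    cont-complete d (e ∷ E) {b ∷ w} st κ | inj₁ (here refl) =
      ∈-++⁺ʳ (newMin d (e ∷ E)) (nonMin-∷⁺ d (cont-complete d E (state-tail st)
        (continuation (drop-∷ (perm κ)) (no123 κ ∘ (_ ∷ʳ_)) (noRise κ ∘ (_ ∷ʳ_)))))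
    -- If a waiting letter other than the largest came first, the larger `e` would follow it later,
    -- contradicting `noRise`.
    cont-complete d (e ∷ E) {b ∷ w} st κ | inj₁ (there b∈E)
      with ∈-resp-↭ (↭-sym (perm κ)) (here refl)
    ... | here refl = contradiction (state-head st (∈-++⁺ˡ b∈E)) (ℕ.<-irrefl refl)
    ... | there e∈w = contradiction (state-head st (∈-++⁺ˡ b∈E))
      (noRise κ (refl ∷ from∈ e∈w) (All.lookup (proj₂ (state-tail st)) b∈E))

  newMin-head : ∀ d E {w} → w ∈ newMin d E → ∃[ b ] ∃[ v ] (w ≡ b ∷ v × b ≤ d)
  newMin-head (suc d) E w∈ with ∈-++⁻ (newMin d (E ++ suc d ∷ [])) w∈
  ... | inj₁ w∈ˡ with b , v , eq , b≤d ← newMin-head d _ w∈ˡ = b , v , eq , ℕ.m≤n⇒m≤1+n b≤d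
  ... | inj₂ w∈ʳ with w , _ , refl ← ∈-map⁻ (suc d ∷_) w∈ʳ = suc d , w , refl , ℕ.≤-refl

  mutual
    newMin-unique : ∀ d E → State d E → Unique (newMin d E)
    newMin-unique zero    E st = []
    newMin-unique (suc d) E st =
      Unique.++⁺ (newMin-unique d _ (state-newMin st))
        (Unique.map⁺ ∷-injectiveʳ (cont-unique d E (state-skip st)))
        (disjoint d _ ℕ.≤-refl)

    cont-unique : ∀ d E → State d E → Unique (cont d E)
    cont-unique zero    []      st = [] ∷ []
    cont-unique (suc d) []      st = Unique.++⁺ (newMin-unique (suc d) [] st) [] λ ()
    cont-unique zero    (e ∷ E) st = Unique.map⁺ ∷-injectiveʳ (cont-unique zero E (state-tail st))
    cont-unique (suc d) (e ∷ E) st =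
      Unique.++⁺ (newMin-unique (suc d) (e ∷ E) st)
        (Unique.map⁺ ∷-injectiveʳ (cont-unique (suc d) E (state-tail st)))
        (disjoint (suc d) _ (All.head (proj₂ st)))

    disjoint : ∀ d E {c ws w} → d < c → ¬ (w ∈ newMin d E × w ∈ map (c ∷_) ws)
    disjoint d E {c} d<c (w∈ˡ , w∈ʳ)
      with _ , _ , refl , b≤d ← newMin-head d E w∈ˡ
         | _ , _ , eq ← ∈-map⁻ (c ∷_) w∈ʳ
      with refl , _ ← ∷-injective eq = ℕ.<⇒≱ d<c b≤d

  continuation-unique : ∀ {d E w} → State d E → Continuation d E w → Unique w
  continuation-unique st κ =
    ↭ₛ.Unique-resp-↭ (setoid ℕ) (↭⇒↭ₛ (↭-sym (perm κ))) (state-unique st)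

  -- Comparison with the list of all 123-avoiding permutations.

  ∈-words⁻ : ∀ A k {w} → w ∈ words A k → length w ≡ k × (∀ {a} → a ∈ w → a ∈ A)
  ∈-words⁻ A zero    (here refl) = refl , λ ()
  ∈-words⁻ A (suc k) w∈
    with a , v , a∈A , v∈ , refl ← ∈-cartesianProductWith⁻ _∷_ A (words A k) w∈
    with len , v⊆A ← ∈-words⁻ A k v∈ =
    cong suc len , λ { (here refl) → a∈A ; (there b∈v) → v⊆A b∈v }

  ∈-words⁺ : ∀ A w → (∀ {a} → a ∈ w → a ∈ A) → w ∈ words A (length w)
  ∈-words⁺ A []      w⊆A = here refl
  ∈-words⁺ A (a ∷ w) w⊆A =
    ∈-cartesianProductWith⁺ _∷_ (w⊆A (here refl)) (∈-words⁺ A w (w⊆A ∘ there))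

  words-unique : ∀ A k → Unique A → Unique (words A k)
  words-unique A zero    u = [] ∷ []
  words-unique A (suc k) u =
    Unique.cartesianProductWith⁺ _∷_ ∷-injective u (words-unique A k u)

  ∈-∃↭ : ∀ {a : ℕ} {ys} → a ∈ ys → ∃[ zs ] (ys ↭ a ∷ zs)
  ∈-∃↭ a∈ with us , vs , refl ← ∈-∃++ a∈ = us ++ vs , ↭.shift _ us vs

  -- A pigeonhole argument: each letter of `xs` is removed from `ys` in turn, and uniqueness ensures
  -- that the later letters survive the removal.
  unique∧⊆⇒↭ : ∀ {xs ys : List ℕ} → Unique xs → (∀ {a} → a ∈ xs → a ∈ ys) →
               length ys ≡ length xs → xs ↭ ys
  unique∧⊆⇒↭ {[]}     {[]} _ _ _ = ↭-refl
  unique∧⊆⇒↭ {x ∷ xs} {ys} (x∉xs ∷ u) xs⊆ys len with zs , p ← ∈-∃↭ (xs⊆ys (here refl)) =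
    ↭-trans (_↭_.prep x (unique∧⊆⇒↭ u xs⊆zs len′)) (↭-sym p)
    where
    len′ : length zs ≡ length xs
    len′ = ℕ.suc-injective (trans (sym (↭-length p)) len)
    xs⊆zs : ∀ {a} → a ∈ xs → a ∈ zs
    xs⊆zs a∈ with ∈-resp-↭ p (xs⊆ys (there a∈))
    ... | here refl  = contradiction refl (All.lookup x∉xs a∈)
    ... | there a∈zs = a∈zs

  rank : ℕ → Word → ℕ
  rank a w = length (filter (ℕ._≤? a) w)

  rank-∷-≤ : ∀ {a b} w → b ≤ a → rank a (b ∷ w) ≡ suc (rank a w)
  rank-∷-≤ {a} w b≤a = cong length (filter-accept (ℕ._≤? a) b≤a)

  rank-∷-> : ∀ {a b} w → a < b → rank a (b ∷ w) ≡ rank a w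
  rank-∷-> {a} w a<b = cong length (filter-reject (ℕ._≤? a) (ℕ.<⇒≱ a<b))

  rank≡0⇒All> : ∀ a w → rank a w ≡ 0 → All (a <_) w
  rank≡0⇒All> a w eq = All.tabulate λ b∈ → ℕ.≰⇒> λ b≤a →
    ℕ.<-irrefl (sym eq) (filter-some (ℕ._≤? a) (Any.map (λ { refl → b≤a }) b∈))

  All>⇒rank≡0 : ∀ {a w} → All (a <_) w → rank a w ≡ 0
  All>⇒rank≡0 {a} big = cong length (filter-none (ℕ._≤? a) (All.map ℕ.<⇒≱ big))

  -- The count includes `a` itself, so rank 1 leaves no other letter below or equal to it.
  rank-head≡1⇒All> : ∀ a w → rank a (a ∷ w) ≡ 1 → All (a <_) w
  rank-head≡1⇒All> a w eq =
    rank≡0⇒All> a w (ℕ.suc-injective (trans (sym (rank-∷-≤ w ℕ.≤-refl)) eq))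

  red-123⁻ : ∀ τ → red τ ≡ 123-pattern →
             ∃[ a ] ∃[ b ] ∃[ c ] (τ ≡ a ∷ b ∷ c ∷ [] × a < b × b < c)
  red-123⁻ (a ∷ b ∷ c ∷ []) eq
    with eq₁ , eq′ ← ∷-injective eq
    with eq₂ , _ ← ∷-injective eq′
    with a<b ∷ _ ← rank-head≡1⇒All> a (b ∷ c ∷ []) eq₁
    with b<c ∷ [] ← rank-head≡1⇒All> b (c ∷ [])
           (ℕ.suc-injective (trans (sym (rank-∷-≤ (b ∷ c ∷ []) (ℕ.<⇒≤ a<b))) eq₂)) =
    a , b , c , refl , a<b , b<c
  red-123⁻ []      ()
  red-123⁻ (_ ∷ []) eq with () ← ∷-injectiveʳ eq
  red-123⁻ (_ ∷ _ ∷ []) eq with () ← ∷-injectiveʳ (∷-injectiveʳ eq)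
  red-123⁻ (_ ∷ _ ∷ _ ∷ _ ∷ _) eq with () ← ∷-injectiveʳ (∷-injectiveʳ (∷-injectiveʳ eq))

  red-123⁺ : ∀ {a b c} → a < b → b < c → red (a ∷ b ∷ c ∷ []) ≡ 123-pattern
  red-123⁺ {a} {b} {c} a<b b<c = cong₂ _∷_ rank-a (cong₂ _∷_ rank-b (cong (_∷ []) rank-c))
    where
    a<c = ℕ.<-trans a<b b<c
    rank-a : rank a (a ∷ b ∷ c ∷ []) ≡ 1
    rank-a = trans (rank-∷-≤ {a} (b ∷ c ∷ []) ℕ.≤-refl) (cong suc (All>⇒rank≡0 (a<b ∷ a<c ∷ [])))
    rank-b : rank b (a ∷ b ∷ c ∷ []) ≡ 2
    rank-b = trans (rank-∷-≤ {b} (b ∷ c ∷ []) (ℕ.<⇒≤ a<b)) (cong suc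
      (trans (rank-∷-≤ {b} (c ∷ []) ℕ.≤-refl) (cong suc (All>⇒rank≡0 (b<c ∷ [])))))
    rank-c : rank c (a ∷ b ∷ c ∷ []) ≡ 3
    rank-c = cong length (filter-all (ℕ._≤? c) (ℕ.<⇒≤ a<c ∷ ℕ.<⇒≤ b<c ∷ ℕ.≤-refl ∷ []))

  avoids⇒no123 : ∀ {w} → Avoids 123-pattern w → No123 w
  avoids⇒no123 av s a<b b<c = av (_ , s , red-123⁺ a<b b<c)

  no123⇒avoids : ∀ {w} → No123 w → Avoids 123-pattern w
  no123⇒avoids av (τ , s , eq) with _ , _ , _ , refl , a<b , b<c ← red-123⁻ τ eq = av s a<b b<c

  -- Both lists are free of duplicates, so equality of their members suffices. The initial state has
  -- no waiting letters, and `noRise` holds vacuously because no letter exceeds `n`.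
  avoiding↭cont : ∀ n → avoiding n 123-pattern ↭ cont n []
  avoiding↭cont n = ∼bag⇒↭ (unique∧set⇒bag
    (Unique.filter⁺ (avoids? 123-pattern) (Unique.filter⁺ (unique? ℕ._≟_) (words-unique letters n unique-letters)))
    (cont-unique n [] ([] , []))
    (mk⇔ to from))
    where
    letters : List ℕ
    letters = applyUpTo suc n

    unique-letters : Unique letters
    unique-letters = Unique.applyUpTo⁺₁ suc n λ i<j _ → ℕ.<⇒≢ (s≤s i<j)

    letters⊆down : ∀ {a} → a ∈ letters → a ∈ down n
    letters⊆down a∈ with _ , i<n , refl ← ∈-applyUpTo⁻ suc a∈ = ∈-applyDownFrom⁺ suc i<n

    down⊆letters : ∀ {a} → a ∈ down n → a ∈ letters
    down⊆letters a∈ with _ , i<n , refl ← ∈-applyDownFrom⁻ suc a∈ = ∈-applyUpTo⁺ suc i<n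

    to : ∀ {w} → w ∈ avoiding n 123-pattern → w ∈ cont n []
    to {w} w∈
      with w∈perms , av ← ∈-filter⁻ (avoids? 123-pattern) {xs = permutations n} w∈
      with w∈words , u ← ∈-filter⁻ (unique? ℕ._≟_) {xs = words letters n} w∈perms
      with len , w⊆ ← ∈-words⁻ letters n w∈words =
      cont-complete n [] ([] , []) (continuation p (avoids⇒no123 av)
        λ s n<a → contradiction (∈-down⁻ (∈-resp-↭ p (lookup s (here refl)))) (ℕ.<⇒≱ n<a))
      where
      p : w ↭ down n
      p = unique∧⊆⇒↭ u (letters⊆down ∘ w⊆) (trans (length-applyDownFrom suc n) (sym len))

    from : ∀ {w} → w ∈ cont n [] → w ∈ avoiding n 123-pattern
    from {w} w∈ = ∈-filter⁺ (avoids? 123-pattern)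
      (∈-filter⁺ (unique? ℕ._≟_)
        (subst (λ k → w ∈ words letters k) len (∈-words⁺ letters w (down⊆letters ∘ ∈-resp-↭ (perm κ))))
        (continuation-unique {n} {[]} ([] , []) κ))
      (no123⇒avoids (no123 κ))
      where
      κ : Continuation n [] w
      κ = cont-sound n [] ([] , []) w∈
      len : length w ≡ n
      len = trans (↭-length (perm κ)) (length-applyDownFrom suc n)

  -- Matches of `γ` and the runs between left-to-right minima.

  module _ (ℓ : ℕ) where
    private
      g : Word
      g = 1 ∷ applyDownFrom (2 ℕ.+_) ℓ

      length-g : length g ≡ suc ℓ
      length-g = cong suc (length-applyDownFrom (2 ℕ.+_) ℓ)

    red-γ⁻ : ∀ c u → red (c ∷ u) ≡ g → All (c <_) u × length u ≡ ℓ
    red-γ⁻ c u eq = rank-head≡1⇒All> c u (∷-injectiveˡ eq) ,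
      ℕ.suc-injective (trans (sym (length-map (λ a → rank a (c ∷ u)) (c ∷ u)))
        (trans (cong length eq) length-g))

    mch-∷-yes : ∀ b w → red (take (length g) (b ∷ w)) ≡ g → mch g (b ∷ w) ≡ suc (mch g w)
    mch-∷-yes b w = cong length ∘ filter-accept (λ w → ≡-dec ℕ._≟_ (red (take (length g) w)) g) {b ∷ w} {tails w}

    mch-∷-no : ∀ b w → red (take (length g) (b ∷ w)) ≢ g → mch g (b ∷ w) ≡ mch g w
    mch-∷-no b w = cong length ∘ filter-reject (λ w → ≡-dec ℕ._≟_ (red (take (length g) w)) g) {b ∷ w} {tails w}

  -- A larger letter put in front does not change the ranks of the others. The `suc` accounts for
  -- the leading letter of `γ`, which lies below the whole word.
  ranks-descending : ∀ {u} → AllPairs _>_ u →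
                     map (λ a → suc (rank a u)) u ≡ applyDownFrom (2 ℕ.+_) (length u)
  ranks-descending [] = refl
  ranks-descending {a ∷ u} (big ∷ desc) = cong₂ _∷_
    (cong suc (trans (rank-∷-≤ u ℕ.≤-refl)
      (cong (suc ∘ length) (filter-all (ℕ._≤? a) (All.map ℕ.<⇒≤ big)))))
    (trans (map-cong-local (All.map (λ a>b → cong suc (rank-∷-> u a>b)) big)) (ranks-descending desc))

  red-γ⁺ : ∀ {c u} → AllPairs _>_ u → All (c <_) u →
           red (c ∷ u) ≡ 1 ∷ applyDownFrom (2 ℕ.+_) (length u)
  red-γ⁺ {c} {u} desc big = cong₂ _∷_
    (trans (rank-∷-≤ u ℕ.≤-refl) (cong suc (All>⇒rank≡0 big)))
    (trans (map-cong-local (All.map (λ c<a → rank-∷-≤ u (ℕ.<⇒≤ c<a)) big)) (ranks-descending desc))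

  pairs⇒AllPairs : ∀ {R : ℕ → ℕ → Set} {u} → (∀ {a c} → a ∷ c ∷ [] ⊆ u → R a c) → AllPairs R u
  pairs⇒AllPairs {u = []}    h = []
  pairs⇒AllPairs {u = a ∷ u} h =
    All.tabulate (λ c∈ → h (refl ∷ from∈ c∈)) ∷ pairs⇒AllPairs (h ∘ (a ∷ʳ_))

  Unique⇒≢ : ∀ {a c : ℕ} {w} → Unique w → a ∷ c ∷ [] ⊆ w → a ≢ c
  Unique⇒≢ (a∉ ∷ u) (refl ∷ s) = All.lookup a∉ (lookup s (here refl))
  Unique⇒≢ (_ ∷ u)  (_ ∷ʳ s)   = Unique⇒≢ u s

  -- In a continuation of a state with `d` low letters, this is the number of letters read before
  -- the next left-to-right minimum.
  run : ℕ → Word → ℕ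
  run d w = length (takeWhile (d ℕ.<?_) w)

  run-∷-> : ∀ {d a} w → d < a → run d (a ∷ w) ≡ suc (run d w)
  run-∷-> {d} {a} w d<a rewrite dec-true (d ℕ.<? a) d<a = refl

  run-∷-≤ : ∀ {d a} w → a ≤ d → run d (a ∷ w) ≡ 0
  run-∷-≤ {d} {a} w a≤d rewrite dec-false (d ℕ.<? a) (ℕ.≤⇒≯ a≤d) = refl

  run-≥⁺ : ∀ d ℓ w → All (d <_) (take ℓ w) → length (take ℓ w) ≡ ℓ → ℓ ≤ run d w
  run-≥⁺ d zero    w       _           _  = z≤n
  run-≥⁺ d (suc ℓ) (a ∷ w) (d<a ∷ big) eq rewrite run-∷-> w d<a =
    s≤s (run-≥⁺ d ℓ w big (ℕ.suc-injective eq))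

  run-≥⁻ : ∀ d ℓ w → ℓ ≤ run d w → All (d <_) (take ℓ w) × length (take ℓ w) ≡ ℓ
  run-≥⁻ d zero    w       _ = [] , refl
  run-≥⁻ d (suc ℓ) (a ∷ w) ℓ<run with d ℕ.<? a
  ... | yes d<a with big , eq ← run-≥⁻ d ℓ w (ℕ.≤-pred (subst (suc ℓ ≤_) (run-∷-> w d<a) ℓ<run)) =
    d<a ∷ big , cong suc eq
  ... | no d≮a with () ← subst (suc ℓ ≤_) (run-∷-≤ w (ℕ.≮⇒≥ d≮a)) ℓ<run

  module _ (p : ℕ) where
    private
      ℓ : ℕ
      ℓ = suc p
      g : Word
      g = γ (suc ℓ)
      red-take : ∀ b w → red (take (length g) (b ∷ w)) ≡ red (b ∷ take ℓ w)
      red-take b w = cong (λ k → red (take (suc k) (b ∷ w))) (length-applyDownFrom (2 ℕ.+_) ℓ)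

    -- This is where `m ≥ 2` enters: a full window at `e` has a second letter, which is smaller than
    -- `e`, whereas `γ` starts with its smallest letter.
    mch-nonMin : ∀ {e} w → (∀ {a} → a ∈ w → a < e) → mch g (e ∷ w) ≡ mch g w
    mch-nonMin {e} w small = mch-∷-no ℓ e w λ eq → no-match w small
      (red-γ⁻ ℓ e (take ℓ w) (trans (sym (red-take e w)) eq))
      where
      no-match : ∀ w → (∀ {a} → a ∈ w → a < e) → ¬ (All (e <_) (take ℓ w) × length (take ℓ w) ≡ ℓ)
      no-match (a ∷ w) small (e<a ∷ _ , _) = ℕ.<-asym e<a (small (here refl))

    -- The next `ℓ` letters exceed `d` and differ from the letter `suc d` just read, so they exceed
    -- it. They descend because `noRise` excludes rises among them and no letter repeats. Hence the
    -- length of the run alone decides whether `γ` matches.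
    mch-newMin-yes : ∀ {d E w} → State (suc d) E → Continuation d E w → ℓ ≤ run d w →
                     mch g (suc d ∷ w) ≡ suc (mch g w)
    mch-newMin-yes {d} {E} {w} st κ ℓ≤run with big , len ← run-≥⁻ d ℓ w ℓ≤run =
      mch-∷-yes ℓ (suc d) w (trans (red-take (suc d) w)
        (trans (red-γ⁺ descending (All.tabulate bigger)) (cong (λ k → 1 ∷ applyDownFrom (2 ℕ.+_) k) len)))
      where
      ⊆w : ∀ {u} → u ⊆ take ℓ w → u ⊆ w
      ⊆w s = ⊆-trans s (take-⊆ ℓ w)
      bigger : ∀ {a} → a ∈ take ℓ w → suc d < a
      bigger a∈ = ℕ.≤∧≢⇒< (All.lookup big a∈)
        (state-≢ st (∈-resp-↭ (perm κ) (lookup (⊆w (from∈ a∈)) (here refl))) ∘ sym)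
      descending : AllPairs _>_ (take ℓ w)
      descending = pairs⇒AllPairs λ s → ℕ.≤∧≢⇒<
        (ℕ.≮⇒≥ (noRise κ (⊆w s) (All.lookup big (lookup s (here refl)))))
        (Unique⇒≢ (continuation-unique (state-skip st) κ) (⊆w s) ∘ sym)

    mch-newMin-no : ∀ {d} w → ¬ ℓ ≤ run d w → mch g (suc d ∷ w) ≡ mch g w
    mch-newMin-no {d} w ℓ≰run = mch-∷-no ℓ (suc d) w λ eq →
      longRun (red-γ⁻ ℓ (suc d) (take ℓ w) (trans (sym (red-take (suc d) w)) eq))
      where
      longRun : ¬ (All (suc d <_) (take ℓ w) × length (take ℓ w) ≡ ℓ)
      longRun (big , len) = ℓ≰run (run-≥⁺ d ℓ w (All.map ℕ.<⇒≤ big) len)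

-- Weighted enumeration of the continuations.

module ListSum {c ℓ} (R : CommutativeRing c ℓ) where
  open CommutativeRing R
  open RingOps rawRing using (∑∈)
  open Algebra.Properties.CommutativeSemigroup +-commutativeSemigroup using (x∙yz≈y∙xz)

  ∑∈-cong : ∀ {A : Set} {f g : A → Carrier} xs → (∀ {a} → a ∈ xs → f a ≈ g a) →
            ∑∈ xs f ≈ ∑∈ xs g
  ∑∈-cong []       eq = refl
  ∑∈-cong (a ∷ xs) eq = +-cong (eq (here ≡.refl)) (∑∈-cong xs (eq ∘ there))

  ∑∈-++ : ∀ {A : Set} (f : A → Carrier) xs ys → ∑∈ (xs ++ ys) f ≈ ∑∈ xs f + ∑∈ ys f
  ∑∈-++ f []       ys = sym (+-identityˡ _)
  ∑∈-++ f (a ∷ xs) ys = trans (+-congˡ (∑∈-++ f xs ys)) (sym (+-assoc _ _ _))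

  ∑∈-map : ∀ {A : Set} (f : A → Carrier) (h : A → A) xs → ∑∈ (map h xs) f ≈ ∑∈ xs (f ∘ h)
  ∑∈-map f h []       = refl
  ∑∈-map f h (a ∷ xs) = +-congˡ (∑∈-map f h xs)

  ∑∈-*ˡ : ∀ {A : Set} u (f : A → Carrier) xs → ∑∈ xs (λ a → u * f a) ≈ u * ∑∈ xs f
  ∑∈-*ˡ u f []       = sym (zeroʳ u)
  ∑∈-*ˡ u f (a ∷ xs) = trans (+-congˡ (∑∈-*ˡ u f xs)) (sym (distribˡ _ _ _))

  ∑∈-↭ : ∀ {A : Set} (f : A → Carrier) {xs ys} → xs ↭ ys → ∑∈ xs f ≈ ∑∈ ys f
  ∑∈-↭ f _↭_.refl         = refl
  ∑∈-↭ f (_↭_.prep a p)   = +-congˡ (∑∈-↭ f p)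
  ∑∈-↭ f (_↭_.swap a b p) = trans (+-congˡ (+-congˡ (∑∈-↭ f p))) (x∙yz≈y∙xz _ _ _)
  ∑∈-↭ f (_↭_.trans p q)  = trans (∑∈-↭ f p) (∑∈-↭ f q)

module Enumeration {c ℓ} (R : CommutativeRing c ℓ) (p : ℕ) (a : CommutativeRing.Carrier R) where
  open Continuations
  open Continuation
  open CommutativeRing R
  open RingOps rawRing using (∑∈; _^_)
  open SeriesRing R using (shift)
  open Composition R
  open ListSum R
  open Relation.Binary.Reasoning.Setoid setoid
  private
    m : ℕ
    m = suc (suc p)
  open Weight R m a using (weight; b)

  monomial : Word → Carrier
  monomial w = a ^ mch (γ m) w

  weight-≥ : ∀ {s} → m ≤ s → weight s ≡ a
  weight-≥ {s} m≤s rewrite dec-true (m ℕ.≤? s) m≤s = ≡.refl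

  weight-≱ : ∀ {s} → ¬ m ≤ s → weight s ≡ 1#
  weight-≱ {s} m≰s rewrite dec-false (m ℕ.≤? s) m≰s = ≡.refl

  -- s is the number of letters read since the last left-to-right minimum,
  -- including the latter.
  weighted : ℕ → ℕ → Word → Carrier
  weighted d s w = weight (s ℕ.+ run d w) * monomial w

  -- The block opened by `suc d` consists of this letter and the run after it, and it has at least
  -- `m` letters exactly when `γ` matches at `suc d`. The factor contributed by the match thus
  -- becomes the weight of the block.
  monomial-newMin : ∀ {d E w} → State (suc d) E → Continuation d E w →
                    monomial (suc d ∷ w) ≈ weighted d 1 w
  monomial-newMin {d} {E} {w} st κ with suc p ℕ.≤? run d w
  ... | yes long = begin
    a ^ mch (γ m) (suc d ∷ w)              ≡⟨ ≡.cong (a ^_) (mch-newMin-yes p st κ long) ⟩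
    a * monomial w                         ≡⟨ ≡.cong (_* monomial w) (weight-≥ (s≤s long)) ⟨
    weight (suc (run d w)) * monomial w    ∎
  ... | no short = begin
    a ^ mch (γ m) (suc d ∷ w)              ≡⟨ ≡.cong (a ^_) (mch-newMin-no p w short) ⟩
    monomial w                             ≈⟨ *-identityˡ _ ⟨
    1# * monomial w                        ≡⟨ ≡.cong (_* monomial w) (weight-≱ (short ∘ ℕ.≤-pred)) ⟨
    weight (suc (run d w)) * monomial w    ∎

  weighted-nonMin : ∀ {d e E w} s → State d (e ∷ E) → Continuation d E w →
                    weighted d s (e ∷ w) ≈ weighted d (suc s) w
  weighted-nonMin {d} {e} {E} {w} s st κ = begin
    weight (s ℕ.+ run d (e ∷ w)) * a ^ mch (γ m) (e ∷ w)
      ≡⟨ ≡.cong₂ (λ i j → weight (s ℕ.+ i) * a ^ j)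
           (run-∷-> w (All.head (proj₂ st)))
           (mch-nonMin p w (state-head st ∘ ∈-resp-↭ (perm κ))) ⟩
    weight (s ℕ.+ suc (run d w)) * monomial w
      ≡⟨ ≡.cong (λ i → weight i * monomial w) (ℕ.+-suc s (run d w)) ⟩
    weight (suc s ℕ.+ run d w) * monomial w ∎

  weighted-newMin : ∀ d E s →
    ∑∈ (newMin d E) (weighted d s) ≈ weight (s ℕ.+ 0) * ∑∈ (newMin d E) monomial
  weighted-newMin d E s = trans (∑∈-cong (newMin d E) head)
    (∑∈-*ˡ (weight (s ℕ.+ 0)) monomial (newMin d E))
    where
    head : ∀ {w} → w ∈ newMin d E → weighted d s w ≈ weight (s ℕ.+ 0) * monomial w
    head w∈ with e , v , ≡.refl , b≤d ← newMin-head d E w∈ =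
      reflexive (≡.cong (λ i → weight (s ℕ.+ i) * monomial (e ∷ v)) (run-∷-≤ v b≤d))

  ∑-map-nonMin : ∀ d {e E} s → State d (e ∷ E) →
    ∑∈ (map (e ∷_) (cont d E)) (weighted d s) ≈ ∑∈ (cont d E) (weighted d (suc s))
  ∑-map-nonMin d {e} {E} s st = trans (∑∈-map (weighted d s) (e ∷_) (cont d E))
    (∑∈-cong (cont d E) λ w∈ → weighted-nonMin s st (cont-sound d E (state-tail st) w∈))

  ∑-cont-zero : ∀ E s → State 0 E → ∑∈ (cont 0 E) (weighted 0 s) ≈ weight (s ℕ.+ length E)
  ∑-cont-zero []      s st = trans (+-identityʳ _) (*-identityʳ _)
  ∑-cont-zero (e ∷ E) s st = begin
    ∑∈ (map (e ∷_) (cont 0 E)) (weighted 0 s) ≈⟨ ∑-map-nonMin 0 s st ⟩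
    ∑∈ (cont 0 E) (weighted 0 (suc s))        ≈⟨ ∑-cont-zero E (suc s) (state-tail st) ⟩
    weight (suc s ℕ.+ length E)               ≡⟨ ≡.cong weight (ℕ.+-suc s (length E)) ⟨
    weight (s ℕ.+ suc (length E))             ∎

  -- The index of the convolution is the number of waiting letters read before the next minimum: at
  -- each point either the block ends, contributing its weight times the count with the remaining
  -- letters, or one more waiting letter is read and `s` increases. The counts for `newMin` enter as
  -- a hypothesis, so the induction here runs over `E` alone.
  ∑-cont-suc : ∀ d (V : S.Carrier) →
    (∀ E → State (suc d) E → ∑∈ (newMin (suc d) E) monomial ≈ shift V (length E)) →
    ∀ E s → State (suc d) E →
    ∑∈ (cont (suc d) E) (weighted (suc d) s) ≈ ((λ i → weight (s ℕ.+ i)) S.* shift V) (length E)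
  ∑-cont-suc d V ih [] s st = begin
    ∑∈ (newMin (suc d) [] ++ []) (weighted (suc d) s)
      ≈⟨ ∑∈-++ (weighted (suc d) s) (newMin (suc d) []) [] ⟩
    ∑∈ (newMin (suc d) []) (weighted (suc d) s) + 0#
      ≈⟨ +-congʳ (trans (weighted-newMin (suc d) [] s) (*-congˡ (ih [] st))) ⟩
    weight (s ℕ.+ 0) * V 1 + 0# ∎
  ∑-cont-suc d V ih (e ∷ E) s st = begin
    ∑∈ (newMin (suc d) (e ∷ E) ++ map (e ∷_) (cont (suc d) E)) (weighted (suc d) s)
      ≈⟨ ∑∈-++ (weighted (suc d) s) (newMin (suc d) (e ∷ E)) _ ⟩
    ∑∈ (newMin (suc d) (e ∷ E)) (weighted (suc d) s) +
    ∑∈ (map (e ∷_) (cont (suc d) E)) (weighted (suc d) s)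
      ≈⟨ +-cong (trans (weighted-newMin (suc d) (e ∷ E) s) (*-congˡ (ih (e ∷ E) st)))
                (trans (∑-map-nonMin (suc d) s st)
                       (∑-cont-suc d V ih E (suc s) (state-tail st))) ⟩
    weight (s ℕ.+ 0) * V (suc (suc (length E))) +
    ((λ i → weight (suc s ℕ.+ i)) S.* shift V) (length E)
      ≈⟨ +-congˡ (S.*-congʳ {shift V}
           (λ i → reflexive (≡.cong weight (≡.sym (ℕ.+-suc s i)))) (length E)) ⟩
    ((λ i → weight (s ℕ.+ i)) S.* shift V) (suc (length E)) ∎

  ∑-map-newMin : ∀ d E → State (suc d) E →
    ∑∈ (map (suc d ∷_) (cont d E)) monomial ≈ ∑∈ (cont d E) (weighted d 1)
  ∑-map-newMin d E st = trans (∑∈-map monomial (suc d ∷_) (cont d E))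
    (∑∈-cong (cont d E) λ w∈ → monomial-newMin st (cont-sound d E (state-skip st) w∈))

  -- The iterates behind `b`, with the new `step` applied outermost: this is the order produced by
  -- the recursion on `d`, while `steps` applies it innermost.
  iterate : ℕ → S.Carrier
  iterate zero    = weight
  iterate (suc n) = step weight (iterate n)

  -- The sum depends on `E` only through its length, which becomes the exponent of a series. The
  -- shift by one reflects that the candidate `suc d` either joins `E` or opens a block of its own.
  ∑-newMin : ∀ d E → State (suc d) E →
             ∑∈ (newMin (suc d) E) monomial ≈ shift (iterate d) (length E)
  ∑-newMin zero    E st = trans (∑-map-newMin 0 E st) (∑-cont-zero E 1 (state-skip st))
  ∑-newMin (suc d) E st = begin
    ∑∈ (newMin (suc d) E⁺ ++ map (2+d ∷_) (cont (suc d) E)) monomial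
      ≈⟨ ∑∈-++ monomial (newMin (suc d) E⁺) _ ⟩
    ∑∈ (newMin (suc d) E⁺) monomial + ∑∈ (map (2+d ∷_) (cont (suc d) E)) monomial
      ≈⟨ +-cong (∑-newMin d E⁺ (state-newMin st)) (trans (∑-map-newMin (suc d) E st)
           (∑-cont-suc d (iterate d) (∑-newMin d) E 1 (state-skip st))) ⟩
    shift (iterate d) (length E⁺) + (shift weight S.* shift (iterate d)) (length E)
      ≡⟨ ≡.cong (λ k → shift (iterate d) k + (shift weight S.* shift (iterate d)) (length E))
           (≡.trans (length-++ E) (ℕ.+-comm (length E) 1)) ⟩
    shift (iterate d) (suc (length E)) + (shift weight S.* shift (iterate d)) (length E)
      -- `weight 0` is 1, so passing over the letter supplies the zeroth term of the convolution.
      ≈⟨ +-congʳ (*-identityˡ _) ⟨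
    (weight S.* shift (iterate d)) (suc (length E)) ∎
    where
    2+d : ℕ
    2+d = suc (suc d)
    E⁺ : List ℕ
    E⁺ = E ++ 2+d ∷ []

  ∑-cont : ∀ n → ∑∈ (cont n []) monomial ≈ iterate n 0
  ∑-cont zero    = +-identityʳ 1#
  ∑-cont (suc n) = begin
    ∑∈ (newMin (suc n) [] ++ []) monomial     ≈⟨ ∑∈-++ monomial (newMin (suc n) []) [] ⟩
    ∑∈ (newMin (suc n) []) monomial + 0#      ≈⟨ +-congʳ (∑-newMin n [] ([] , [])) ⟩
    iterate n 1 + 0#                          ≈⟨ +-congʳ (*-identityˡ _) ⟨
    1# * iterate n 1 + 0#                     ∎

  steps-step : ∀ n f → steps weight n (step weight f) ≡ step weight (steps weight n f)
  steps-step zero    f = ≡.refl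
  steps-step (suc n) f = steps-step n (step weight f)

  steps≡iterate : ∀ n → steps weight n weight ≡ iterate n
  steps≡iterate zero    = ≡.refl
  steps≡iterate (suc n) =
    ≡.trans (steps-step n weight) (≡.cong (step weight) (steps≡iterate n))

  ∑-avoiding : ∀ n → ∑∈ (avoiding n 123-pattern) monomial ≈ b n
  ∑-avoiding n = begin
    ∑∈ (avoiding n 123-pattern) monomial ≈⟨ ∑∈-↭ monomial (avoiding↭cont n) ⟩
    ∑∈ (cont n []) monomial              ≈⟨ ∑-cont n ⟩
    iterate n 0                          ≡⟨ ≡.cong (λ V → V 0) (steps≡iterate n) ⟨
    b n                                  ∎

-- Factorial identities and integers inside the rationals.

module Arithmetic where
  open ≡ using (refl; sym; trans; cong; cong₂; module ≡-Reasoning)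

  nCk*k![n∸k]!≡n! : ∀ {n k} → k ≤ n → (n C k) ℕ.* (k ! ℕ.* (n ∸ k) !) ≡ n !
  nCk*k![n∸k]!≡n! {n} {k} k≤n = trans
    (cong (ℕ._* (k ! ℕ.* (n ∸ k) !)) (nCk≡n!/k![n-k]! k≤n))
    (ℕ.m/n*n≡m (k![n∸k]!∣n! k≤n))
    where instance
    nonZero : NonZero (k ! ℕ.* (n ∸ k) !)
    nonZero = k ℕ.!* (n ∸ k) !≢0

  nC0≡1 : ∀ n → n C 0 ≡ 1
  nC0≡1 n = trans (nCk≡nC[n∸k] {n = n} z≤n) (nCn≡1 n)

  -- Cleared of denominators, this says that the three binomial coefficients multiply to
  -- `(n + 1)/(k + 1)` times the multinomial coefficient. The factorials of `i`, `suc n` and `n + c`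
  -- are split in turn; `c` will be `n − m i`.
  term-identity : ∀ n k i c → suc k ≤ i → i ≤ suc n →
    ((suc n C i) ℕ.* ((i C suc k) ℕ.* ((n ℕ.+ c) C n))) ℕ.*
      (suc k ℕ.* (c ! ℕ.* (suc n ∸ i) ! ℕ.* (k ! ℕ.* (i ∸ suc k) !))) ≡
    suc n ℕ.* (n ℕ.+ c) !
  term-identity n k i c k<i i≤1+n = begin
    (A ℕ.* (I ℕ.* G)) ℕ.* (suc k ℕ.* (c ! ℕ.* b ! ℕ.* (k ! ℕ.* r !)))
      ≡⟨ regroup A I G (suc k) (c !) (b !) (k !) (r !) ⟩
    A ℕ.* ((I ℕ.* (suc k ! ℕ.* r !)) ℕ.* b !) ℕ.* (G ℕ.* c !)
      ≡⟨ cong (λ z → A ℕ.* (z ℕ.* b !) ℕ.* (G ℕ.* c !)) (nCk*k![n∸k]!≡n! k<i) ⟩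
    A ℕ.* (i ! ℕ.* b !) ℕ.* (G ℕ.* c !)
      ≡⟨ cong (ℕ._* (G ℕ.* c !)) (nCk*k![n∸k]!≡n! i≤1+n) ⟩
    suc n ! ℕ.* (G ℕ.* c !)
      ≡⟨ regroup′ (suc n) (n !) G (c !) ⟩
    suc n ℕ.* (G ℕ.* (n ! ℕ.* c !))
      ≡⟨ cong (λ z → suc n ℕ.* (G ℕ.* (n ! ℕ.* z !))) (ℕ.m+n∸m≡n n c) ⟨
    suc n ℕ.* (G ℕ.* (n ! ℕ.* (n ℕ.+ c ∸ n) !))
      ≡⟨ cong (suc n ℕ.*_) (nCk*k![n∸k]!≡n! (ℕ.m≤m+n n c)) ⟩
    suc n ℕ.* (n ℕ.+ c) ! ∎
    where
    open ≡-Reasoning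
    A I G b r : ℕ
    A = suc n C i
    I = i C suc k
    G = (n ℕ.+ c) C n
    b = suc n ∸ i
    r = i ∸ suc k
    regroup : ∀ A I G K c! b! k! r! →
      (A ℕ.* (I ℕ.* G)) ℕ.* (K ℕ.* (c! ℕ.* b! ℕ.* (k! ℕ.* r!))) ≡
      A ℕ.* ((I ℕ.* (K ℕ.* k! ℕ.* r!)) ℕ.* b!) ℕ.* (G ℕ.* c!)
    regroup = solve-∀
    regroup′ : ∀ N n! G c! → N ℕ.* n! ℕ.* (G ℕ.* c!) ≡ N ℕ.* (G ℕ.* (n! ℕ.* c!))
    regroup′ = solve-∀

  module Q = CommutativeRing ℚ.+-*-commutativeRing

  fraction : ∀ a k d s e .{{_ : NonZero k}} .{{_ : NonZero d}} → e ℕ.* (k ℕ.* d) ≡ s ℕ.* a →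
             (+ s ℚ./ 1) ℚ.* ((+ 1 ℚ./ k) ℚ.* (+ a ℚ./ d)) ≡ + e ℚ./ 1
  fraction a (suc k) (suc d) s e eq = ℚ.toℚᵘ-injective (begin
    ℚ.toℚᵘ ((+ s ℚ./ 1) ℚ.* ((+ 1 ℚ./ suc k) ℚ.* (+ a ℚ./ suc d)))
      ≈⟨ ℚᵘ.≃-trans (ℚ.toℚᵘ-homo-* (+ s ℚ./ 1) _) (ℚᵘ.*-cong (ℚ.toℚᵘ-fromℚᵘ (mkℚᵘ (+ s) 0))
           (ℚᵘ.≃-trans (ℚ.toℚᵘ-homo-* (+ 1 ℚ./ suc k) _)
             (ℚᵘ.*-cong (ℚ.toℚᵘ-fromℚᵘ (mkℚᵘ (+ 1) k)) (ℚ.toℚᵘ-fromℚᵘ (mkℚᵘ (+ a) d))))) ⟩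
    mkℚᵘ (+ s) 0 ℚᵘ.* (mkℚᵘ (+ 1) k ℚᵘ.* mkℚᵘ (+ a) d)
      ≈⟨ *≡* cross ⟩
    mkℚᵘ (+ e) 0  ≈⟨ ℚ.toℚᵘ-fromℚᵘ (mkℚᵘ (+ e) 0) ⟨
    ℚ.toℚᵘ (+ e ℚ./ 1) ∎)
    where
    open ℚᵘ.≃-Reasoning
    cross : (+ s ℤ.* (+ 1 ℤ.* + a)) ℤ.* + 1 ≡ + e ℤ.* + (1 ℕ.* (suc k ℕ.* suc d))
    cross = trans (ℤ.*-identityʳ _) (trans (cong (+ s ℤ.*_) (ℤ.*-identityˡ (+ a)))
      (trans (sym (ℤ.pos-* s a)) (trans (cong +_ (sym (trans (cong (e ℕ.*_) (ℕ.*-identityˡ (suc k ℕ.* suc d))) eq)))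
        (ℤ.pos-* e _))))

  ι : ℕ → ℚ
  ι n = + n ℚ./ 1

  toℚᵘ-ι : ∀ n → ℚ.toℚᵘ (ι n) ℚᵘ.≃ mkℚᵘ (+ n) 0
  toℚᵘ-ι n = ℚ.toℚᵘ-fromℚᵘ (mkℚᵘ (+ n) 0)

  ι-+ : ∀ a b → ι (a ℕ.+ b) ≡ ι a ℚ.+ ι b
  ι-+ a b = ℚ.toℚᵘ-injective (begin
    ℚ.toℚᵘ (ι (a ℕ.+ b))                  ≈⟨ toℚᵘ-ι (a ℕ.+ b) ⟩
    mkℚᵘ (+ (a ℕ.+ b)) 0                  ≈⟨ *≡* (cong (ℤ._* + 1)
                                               (sym (cong₂ ℤ._+_ (ℤ.*-identityʳ (+ a)) (ℤ.*-identityʳ (+ b))))) ⟩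
    mkℚᵘ (+ a) 0 ℚᵘ.+ mkℚᵘ (+ b) 0        ≈⟨ ℚᵘ.+-cong (toℚᵘ-ι a) (toℚᵘ-ι b) ⟨
    ℚ.toℚᵘ (ι a) ℚᵘ.+ ℚ.toℚᵘ (ι b)        ≈⟨ ℚ.toℚᵘ-homo-+ (ι a) (ι b) ⟨
    ℚ.toℚᵘ (ι a ℚ.+ ι b)                  ∎)
    where open ℚᵘ.≃-Reasoning

  ι-* : ∀ a b → ι (a ℕ.* b) ≡ ι a ℚ.* ι b
  ι-* a b = ℚ.toℚᵘ-injective (begin
    ℚ.toℚᵘ (ι (a ℕ.* b))                  ≈⟨ toℚᵘ-ι (a ℕ.* b) ⟩
    mkℚᵘ (+ (a ℕ.* b)) 0                  ≈⟨ *≡* (cong (ℤ._* + 1) (ℤ.pos-* a b)) ⟩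
    mkℚᵘ (+ a) 0 ℚᵘ.* mkℚᵘ (+ b) 0        ≈⟨ ℚᵘ.*-cong (toℚᵘ-ι a) (toℚᵘ-ι b) ⟨
    ℚ.toℚᵘ (ι a) ℚᵘ.* ℚ.toℚᵘ (ι b)        ≈⟨ ℚ.toℚᵘ-homo-* (ι a) (ι b) ⟨
    ℚ.toℚᵘ (ι a ℚ.* ι b)                  ∎)
    where open ℚᵘ.≃-Reasoning

  ι-cancel : ∀ n {p q} → ι (suc n) ℚ.* p ≡ ι (suc n) ℚ.* q → p ≡ q
  ι-cancel n {p} {q} eq = trans (sym (scaled p)) (trans (cong (inv ℚ.*_) eq) (scaled q))
    where
    inv : ℚ
    -- The factor `1ℚ` is the fraction 1/1, which gives the product the shape treated by `fraction`.
    inv = (+ 1 ℚ./ suc n) ℚ.* 1ℚ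
    scaled : ∀ r → inv ℚ.* (ι (suc n) ℚ.* r) ≡ r
    scaled r = trans (sym (ℚ.*-assoc inv (ι (suc n)) r)) (trans (cong (ℚ._* r)
      (trans (ℚ.*-comm inv (ι (suc n))) (fraction 1 (suc n) 1 (suc n) 1
        (trans (ℕ.*-identityˡ (suc n ℕ.* 1)) refl))))
      (ℚ.*-identityˡ r))

  -- Polynomial coefficients and ranges of summation.

  open PolynomialRing ℚ.+-*-commutativeRing
    using (polynomialCommutativeRing; coeff-+; coeff-*; coeff-neg)
  module K = CommutativeRing polynomialCommutativeRing
  module ×K = Algebra.Properties.Semiring.Mult K.semiring
  open ×K using () renaming (_×_ to _×ᴷ_)
  open RingOps ℚ[x] using () renaming (_^_ to _^ᴷ_; sum to sumᴷ)
  open RingOps ℚ-ring using (∑[_⋯_]) renaming (_^_ to _^ℚ_; sum to sumℚ)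

  coeff-× : ∀ n p k → coeff (n ×ᴷ p) k ≡ ι n ℚ.* coeff p k
  coeff-× zero    p k = sym (ℚ.*-zeroˡ (coeff p k))
  coeff-× (suc n) p k = begin
    coeff (p K.+ n ×ᴷ p) k                        ≡⟨ coeff-+ p (n ×ᴷ p) k ⟩
    coeff p k ℚ.+ coeff (n ×ᴷ p) k                ≡⟨ cong₂ ℚ._+_ (sym (ℚ.*-identityˡ (coeff p k))) (coeff-× n p k) ⟩
    ι 1 ℚ.* coeff p k ℚ.+ ι n ℚ.* coeff p k       ≡⟨ ℚ.*-distribʳ-+ (coeff p k) (ι 1) (ι n) ⟨
    (ι 1 ℚ.+ ι n) ℚ.* coeff p k                   ≡⟨ cong (ℚ._* coeff p k) (ι-+ 1 n) ⟨
    ι (suc n) ℚ.* coeff p k                       ∎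
    where open ≡-Reasoning

  coeff-sum : ∀ {j} (F : Fin j → Poly) k → coeff (sumᴷ F) k ≡ sumℚ (λ i → coeff (F i) k)
  coeff-sum {zero}  F k = refl
  coeff-sum {suc j} F k = trans (coeff-+ (F zero) (sumᴷ (λ i → F (suc i))) k)
    (cong (coeff (F zero) k ℚ.+_) (coeff-sum (λ i → F (suc i)) k))

  ×ᴷ-cancel : ∀ n {p q} → suc n ×ᴷ p K.≈ suc n ×ᴷ q → p K.≈ q
  ×ᴷ-cancel n {p} {q} eq k =
    ι-cancel n (trans (sym (coeff-× (suc n) p k)) (trans (eq k) (coeff-× (suc n) q k)))

  module Sℚ = Composition ℚ.+-*-commutativeRing

  coeff-[X-1]* : ∀ p k → coeff ((X K.- K.1#) K.* p) k ≡
                 (PowerSeries.T ℚ-ring Sℚ.S.* coeff p) k ℚ.+ ℚ.- coeff p k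
  coeff-[X-1]* p k = begin
    coeff ((X K.- K.1#) K.* p) k                ≡⟨ K.distribʳ p X (K.- K.1#) k ⟩
    coeff (X K.* p K.+ K.- K.1# K.* p) k        ≡⟨ coeff-+ (X K.* p) (K.- K.1# K.* p) k ⟩
    coeff (X K.* p) k ℚ.+ coeff (K.- K.1# K.* p) k
      ≡⟨ cong₂ ℚ._+_ (trans (coeff-* X p k) (Sℚ.S.*-congʳ {coeff p} coeff-X k))
           (trans (-1*x≈-x p k) (coeff-neg p k)) ⟩
    (PowerSeries.T ℚ-ring Sℚ.S.* coeff p) k ℚ.+ ℚ.- coeff p k ∎
    where
    open ≡-Reasoning
    open Algebra.Properties.Ring K.ring using (-1*x≈-x)
    coeff-X : ∀ k → coeff X k ≡ PowerSeries.T ℚ-ring k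
    coeff-X zero          = refl
    coeff-X (suc zero)    = refl
    coeff-X (suc (suc k)) = refl

  -- Multiplication by `X − 1` takes the difference of neighbouring coefficients, and the
  -- alternating sign turns it into the sum in Pascal's rule. The truncated exponent `i ∸ k` does no
  -- harm for `k > i`, where the binomial coefficient vanishes.
  coeff-[X-1]^ : ∀ i k → coeff ((X K.- K.1#) ^ᴷ i) k ≡ (ℚ.- 1ℚ) ^ℚ (i ∸ k) ℚ.* ι (i C k)
  coeff-[X-1]^ zero    zero    = refl
  coeff-[X-1]^ zero    (suc k) = refl
  coeff-[X-1]^ (suc i) zero    = begin
    coeff ((X K.- K.1#) K.* P) 0
      ≡⟨ coeff-[X-1]* P 0 ⟩
    (PowerSeries.T ℚ-ring Sℚ.S.* coeff P) 0 ℚ.+ ℚ.- coeff P 0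
      ≡⟨ cong₂ (λ r q → r ℚ.+ ℚ.- q) (Sℚ.T-*-zero (coeff P)) (coeff-[X-1]^ i 0) ⟩
    0ℚ ℚ.+ ℚ.- (s ℚ.* ι (i C 0))            ≡⟨ ℚ.+-identityˡ _ ⟩
    ℚ.- (s ℚ.* ι (i C 0))                   ≡⟨ ℚ.neg-distribˡ-* s _ ⟩
    ℚ.- s ℚ.* ι (i C 0)
      ≡⟨ cong₂ (λ r c → r ℚ.* ι c) (sym (-1*x≈-x s)) (trans (nC0≡1 i) (sym (nC0≡1 (suc i)))) ⟩
    (ℚ.- 1ℚ ℚ.* s) ℚ.* ι (suc i C 0)        ∎
    where
    open ≡-Reasoning
    open Algebra.Properties.Ring Q.ring using (-1*x≈-x)
    P : Poly
    P = (X K.- K.1#) ^ᴷ i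
    s : ℚ
    s = (ℚ.- 1ℚ) ^ℚ i
  coeff-[X-1]^ (suc i) (suc k) = begin
    coeff ((X K.- K.1#) K.* P) (suc k)
      ≡⟨ coeff-[X-1]* P (suc k) ⟩
    (PowerSeries.T ℚ-ring Sℚ.S.* coeff P) (suc k) ℚ.+ ℚ.- coeff P (suc k)
      ≡⟨ cong₂ (λ r q → r ℚ.+ ℚ.- q) (trans (Sℚ.T-*-suc (coeff P) k) (coeff-[X-1]^ i k))
               (coeff-[X-1]^ i (suc k)) ⟩
    sign (i ∸ k) ℚ.* ι (i C k) ℚ.+ ℚ.- (sign (i ∸ suc k) ℚ.* ι (i C suc k))
      ≡⟨ cong (sign (i ∸ k) ℚ.* ι (i C k) ℚ.+_) flip ⟩
    sign (i ∸ k) ℚ.* ι (i C k) ℚ.+ sign (i ∸ k) ℚ.* ι (i C suc k)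
      ≡⟨ ℚ.*-distribˡ-+ (sign (i ∸ k)) _ _ ⟨
    sign (i ∸ k) ℚ.* (ι (i C k) ℚ.+ ι (i C suc k))
      ≡⟨ cong (sign (i ∸ k) ℚ.*_) (trans (sym (ι-+ (i C k) _)) (cong ι (nCk+nC[k+1]≡[n+1]C[k+1] i k))) ⟩
    sign (i ∸ k) ℚ.* ι (suc i C suc k) ∎
    where
    open ≡-Reasoning
    open Algebra.Properties.Ring Q.ring using (-1*x≈-x)
    P : Poly
    P = (X K.- K.1#) ^ᴷ i
    sign : ℕ → ℚ
    sign j = (ℚ.- 1ℚ) ^ℚ j
    flip : ℚ.- (sign (i ∸ suc k) ℚ.* ι (i C suc k)) ≡ sign (i ∸ k) ℚ.* ι (i C suc k)
    -- For `k < i` the two exponents differ by one, which absorbs the minus sign; otherwise both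
    -- sides contain a vanishing binomial coefficient.
    flip with k ℕ.<? i
    ... | yes k<i = begin
      ℚ.- (sign (i ∸ suc k) ℚ.* ι (i C suc k))   ≡⟨ ℚ.neg-distribˡ-* (sign (i ∸ suc k)) _ ⟩
      ℚ.- sign (i ∸ suc k) ℚ.* ι (i C suc k)     ≡⟨ cong (ℚ._* ι (i C suc k)) (-1*x≈-x (sign (i ∸ suc k))) ⟨
      sign (suc (i ∸ suc k)) ℚ.* ι (i C suc k)   ≡⟨ cong (λ j → sign j ℚ.* ι (i C suc k)) (ℕ.+-∸-assoc 1 k<i) ⟨
      sign (i ∸ k) ℚ.* ι (i C suc k)             ∎
    ... | no k≮i rewrite k>n⇒nCk≡0 {i} {suc k} (s≤s (ℕ.≮⇒≥ k≮i)) =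
      trans (cong ℚ.-_ (ℚ.*-zeroʳ (sign (i ∸ suc k)))) (sym (ℚ.*-zeroʳ (sign (i ∸ k))))

  sum-zero : ∀ N (f : ℕ → ℚ) → (∀ i → f i ≡ 0ℚ) → sumℚ {N} (f ∘ toℕ) ≡ 0ℚ
  sum-zero zero    f f≡0 = refl
  sum-zero (suc N) f f≡0 = trans (cong₂ ℚ._+_ (f≡0 0) (sum-zero N (f ∘ suc) (f≡0 ∘ suc))) (ℚ.+-identityˡ 0ℚ)

  sum-dropʳ : ∀ {M N} (f : ℕ → ℚ) → M ≤ N → (∀ i → M ≤ i → f i ≡ 0ℚ) →
              sumℚ {N} (f ∘ toℕ) ≡ sumℚ {M} (f ∘ toℕ)
  sum-dropʳ {N = N} f z≤n f≡0 = sum-zero N f λ i → f≡0 i z≤n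
  sum-dropʳ f (s≤s M≤N) f≡0 =
    cong (f 0 ℚ.+_) (sum-dropʳ (f ∘ suc) M≤N λ i M≤i → f≡0 (suc i) (s≤s M≤i))

  sum-dropˡ : ∀ k N (f : ℕ → ℚ) → (∀ i → i < k → f i ≡ 0ℚ) →
              sumℚ {N} (f ∘ toℕ) ≡ sumℚ {N ∸ k} (λ j → f (k ℕ.+ toℕ j))
  sum-dropˡ zero    N       f f≡0 = refl
  sum-dropˡ (suc k) zero    f f≡0 = refl
  sum-dropˡ (suc k) (suc N) f f≡0 = trans
    (cong₂ ℚ._+_ (f≡0 0 (s≤s z≤n)) (sum-dropˡ k N (f ∘ suc) (λ i i<k → f≡0 (suc i) (s≤s i<k))))
    (ℚ.+-identityˡ _)

  sum-range : ∀ k b N (f : ℕ → ℚ) → b < N →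
              (∀ i → i < k → f i ≡ 0ℚ) → (∀ i → b < i → f i ≡ 0ℚ) →
              sumℚ {N} (f ∘ toℕ) ≡ ∑[ k ⋯ b ] f
  sum-range k b N f b<N f≡0ˡ f≡0ʳ =
    trans (sum-dropʳ f b<N f≡0ʳ) (sum-dropˡ k (suc b) f f≡0ˡ)

  sum-cong-range : ∀ k b (f g : ℕ → ℚ) → (∀ i → k ≤ i → i ≤ b → f i ≡ g i) → ∑[ k ⋯ b ] f ≡ ∑[ k ⋯ b ] g
  sum-cong-range k b f g eq = sum-cong-≋ {suc b ∸ k} λ j →
    eq (k ℕ.+ toℕ j) (ℕ.m≤m+n k (toℕ j)) (ℕ.≤-pred (shifted k (toℕ<n j)))
    where
    open Algebra.Properties.Semiring.Sum Q.semiring using (sum-cong-≋)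
    shifted : ∀ k {j M} → j < M ∸ k → k ℕ.+ j < M
    shifted zero    j<M           = j<M
    shifted (suc k) {M = suc M} j<M = s≤s (shifted k j<M)

  -- The coefficient formula.

  module Coefficients (p : ℕ) where
    private
      m : ℕ
      m = suc (suc p)
      module SK = Composition polynomialCommutativeRing
      module W = Weight polynomialCommutativeRing m X
    open PowerSeries ℚ[x] using (T)
    open RingOps SK.S.rawRing using () renaming (_^_ to _^ˢ_)

    B≈b : B m SK.S.≈ W.b
    B≈b = Enumeration.∑-avoiding polynomialCommutativeRing p X

    -- The coefficient of uⁿ in u^(m i) / (1 − u)ⁿ⁺¹.
    tail : ℕ → ℕ → Poly
    tail n i = (T ^ˢ (m ℕ.* i) SK.S.* SK.ones ^ˢ suc n) n

    tail-≤ : ∀ n i → m ℕ.* i ≤ n → tail n i K.≈ ((n ℕ.+ (n ∸ m ℕ.* i)) C n) ×ᴷ K.1#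
    tail-≤ n i mi≤n = begin
      (T ^ˢ (m ℕ.* i) SK.S.* SK.ones ^ˢ suc n) n
        ≡⟨ cong (T ^ˢ (m ℕ.* i) SK.S.* SK.ones ^ˢ suc n) (ℕ.m+[n∸m]≡n mi≤n) ⟨
      (T ^ˢ (m ℕ.* i) SK.S.* SK.ones ^ˢ suc n) (m ℕ.* i ℕ.+ (n ∸ m ℕ.* i))
        ≈⟨ SK.T^-*-+ (m ℕ.* i) (SK.ones ^ˢ suc n) (n ∸ m ℕ.* i) ⟩
      (SK.ones ^ˢ suc n) (n ∸ m ℕ.* i)
        ≈⟨ SK.ones^-coefficient n (n ∸ m ℕ.* i) ⟩
      ((n ℕ.+ (n ∸ m ℕ.* i)) C n) ×ᴷ K.1# ∎
      where open Relation.Binary.Reasoning.Setoid K.setoid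

    tail-> : ∀ n i → n < m ℕ.* i → tail n i K.≈ K.0#
    tail-> n i n<mi = SK.T^-*-< (m ℕ.* i) (SK.ones ^ˢ suc n) n<mi

    *-tail-≤ : ∀ P n i → m ℕ.* i ≤ n →
               P K.* tail n i K.≈ ((n ℕ.+ (n ∸ m ℕ.* i)) C n) ×ᴷ P
    *-tail-≤ P n i mi≤n = begin
      P K.* tail n i         ≈⟨ K.*-congˡ {P} (tail-≤ n i mi≤n) ⟩
      P K.* (G ×ᴷ K.1#)      ≈⟨ ×K.×-comm-* G P K.1# ⟩
      G ×ᴷ (P K.* K.1#)      ≈⟨ ×K.×-congʳ G (K.*-identityʳ P) ⟩
      G ×ᴷ P                 ∎
      where
      open Relation.Binary.Reasoning.Setoid K.setoid
      G : ℕ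
      G = (n ℕ.+ (n ∸ m ℕ.* i)) C n

    *-tail-> : ∀ P n i → n < m ℕ.* i → P K.* tail n i K.≈ K.0#
    *-tail-> P n i n<mi = begin
      P K.* tail n i   ≈⟨ K.*-congˡ {P} (tail-> n i n<mi) ⟩
      P K.* K.0#       ≈⟨ K.zeroʳ P ⟩
      K.0#             ∎
      where open Relation.Binary.Reasoning.Setoid K.setoid

    term : ℕ → ℕ → ℕ → ℚ
    term n k i = coeff ((suc n C i) ×ᴷ ((X K.- K.1#) ^ᴷ i K.* tail n i)) k

    ∑-term : ∀ n k → ι (suc n) ℚ.* coeff (B m n) k ≡ sumℚ {suc (suc n)} (term n k ∘ toℕ)
    ∑-term n k = begin
      ι (suc n) ℚ.* coeff (B m n) k     ≡⟨ cong (ι (suc n) ℚ.*_) (B≈b n k) ⟩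
      ι (suc n) ℚ.* coeff (W.b n) k     ≡⟨ coeff-× (suc n) (W.b n) k ⟨
      coeff (suc n ×ᴷ W.b n) k
        ≡⟨ Lagrange.lagrange-T polynomialCommutativeRing ×ᴷ-cancel W.weight n k ⟩
      coeff ((W.weight ^ˢ suc n) n) k   ≡⟨ W.weight^-coefficient (suc n) n k ⟩
      coeff (sumᴷ {suc (suc n)} (λ i → F (toℕ i))) k  ≡⟨ coeff-sum {suc (suc n)} (F ∘ toℕ) k ⟩
      sumℚ {suc (suc n)} (term n k ∘ toℕ) ∎
      where
      open ≡-Reasoning
      F : ℕ → Poly
      F i = (suc n C i) ×ᴷ ((X K.- K.1#) ^ᴷ i K.* tail n i)

    term-≤ : ∀ n k i → m ℕ.* i ≤ n → term n k i ≡
      (ℚ.- 1ℚ) ^ℚ (i ∸ k) ℚ.* ι ((suc n C i) ℕ.* ((i C k) ℕ.* ((n ℕ.+ (n ∸ m ℕ.* i)) C n)))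
    term-≤ n k i mi≤n = begin
      coeff (A ×ᴷ (P K.* tail n i)) k             ≡⟨ coeff-× A (P K.* tail n i) k ⟩
      ι A ℚ.* coeff (P K.* tail n i) k            ≡⟨ cong (ι A ℚ.*_) inner ⟩
      ι A ℚ.* (ι G ℚ.* (s ℚ.* ι I))               ≡⟨ cong (ι A ℚ.*_) (x∙yz≈y∙zx (ι G) s (ι I)) ⟩
      ι A ℚ.* (s ℚ.* (ι I ℚ.* ι G))               ≡⟨ x∙yz≈y∙xz (ι A) s _ ⟩
      s ℚ.* (ι A ℚ.* (ι I ℚ.* ι G))
        ≡⟨ cong (s ℚ.*_) (trans (ι-* A (I ℕ.* G)) (cong (ι A ℚ.*_) (ι-* I G))) ⟨
      s ℚ.* ι (A ℕ.* (I ℕ.* G))                   ∎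
      where
      open ≡-Reasoning
      open Algebra.Properties.CommutativeSemigroup Q.*-commutativeSemigroup using (x∙yz≈y∙xz; x∙yz≈y∙zx)
      A I G : ℕ
      A = suc n C i
      I = i C k
      G = (n ℕ.+ (n ∸ m ℕ.* i)) C n
      P : Poly
      P = (X K.- K.1#) ^ᴷ i
      s : ℚ
      s = (ℚ.- 1ℚ) ^ℚ (i ∸ k)
      inner : coeff (P K.* tail n i) k ≡ ι G ℚ.* (s ℚ.* ι I)
      inner = trans (*-tail-≤ P n i mi≤n k) (trans (coeff-× G P k) (cong (ι G ℚ.*_) (coeff-[X-1]^ i k)))

    term-> : ∀ n k i → n < m ℕ.* i → term n k i ≡ 0ℚ
    term-> n k i n<mi = begin
      term n k i                         ≡⟨ coeff-× (suc n C i) (P K.* tail n i) k ⟩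
      ι (suc n C i) ℚ.* coeff (P K.* tail n i) k
        ≡⟨ cong (ι (suc n C i) ℚ.*_) (*-tail-> P n i n<mi k) ⟩
      ι (suc n C i) ℚ.* 0ℚ               ≡⟨ ℚ.*-zeroʳ (ι (suc n C i)) ⟩
      0ℚ                                 ∎
      where
      open ≡-Reasoning
      P : Poly
      P = (X K.- K.1#) ^ᴷ i

    -- `(X − 1)ⁱ` has degree `i`, so it has no coefficient at `k > i`. The closed form that exhibits
    -- the zero binomial coefficient holds only for `m i ≤ n`; beyond that bound `tail` vanishes.
    term-low : ∀ n k i → i < k → term n k i ≡ 0ℚ
    term-low n k i i<k with m ℕ.* i ℕ.≤? n
    ... | no mi≰n  = term-> n k i (ℕ.≰⇒> mi≰n)
    ... | yes mi≤n = begin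
      term n k i           ≡⟨ term-≤ n k i mi≤n ⟩
      (ℚ.- 1ℚ) ^ℚ (i ∸ k) ℚ.* ι ((suc n C i) ℕ.* ((i C k) ℕ.* G))
        ≡⟨ cong (λ c → (ℚ.- 1ℚ) ^ℚ (i ∸ k) ℚ.* ι ((suc n C i) ℕ.* (c ℕ.* G))) (k>n⇒nCk≡0 i<k) ⟩
      (ℚ.- 1ℚ) ^ℚ (i ∸ k) ℚ.* ι ((suc n C i) ℕ.* 0)
        ≡⟨ cong (λ c → (ℚ.- 1ℚ) ^ℚ (i ∸ k) ℚ.* ι c) (ℕ.*-zeroʳ (suc n C i)) ⟩
      (ℚ.- 1ℚ) ^ℚ (i ∸ k) ℚ.* 0ℚ   ≡⟨ ℚ.*-zeroʳ ((ℚ.- 1ℚ) ^ℚ (i ∸ k)) ⟩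
      0ℚ ∎
      where
      open ≡-Reasoning
      G : ℕ
      G = (n ℕ.+ (n ∸ m ℕ.* i)) C n

    summand : ℕ → ℕ → ℕ → ℚ
    summand n k i = (ℚ.- 1ℚ) ^ℚ (i ∸ k) ℚ.*
      multinomial (2 ℕ.* n ∸ m ℕ.* i) (n ∸ m ℕ.* i) ((n ℕ.+ 1) ∸ i) (k ∸ 1) (i ∸ k)

    ≤n/m⇒m*≤n : ∀ {n i} → i ≤ n ℕ./ m → m ℕ.* i ≤ n
    ≤n/m⇒m*≤n {n} {i} i≤ = ℕ.≤-trans (ℕ.*-monoʳ-≤ m i≤)
      (ℕ.≤-trans (ℕ.≤-reflexive (ℕ.*-comm m (n ℕ./ m))) (ℕ.m/n*n≤m n m))

    >n/m⇒m*>n : ∀ {n i} → n ℕ./ m < i → n < m ℕ.* i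
    >n/m⇒m*>n {n} {i} i> = ℕ.≰⇒> λ mi≤n → ℕ.<⇒≱ i>
      (ℕ.≤-trans (ℕ.≤-reflexive (trans (sym (ℕ.m*n/n≡m i m)) (cong (ℕ._/ m) (ℕ.*-comm i m))))
                 (ℕ./-monoˡ-≤ m mi≤n))

    -- The factor `n + 1` comes from Lagrange inversion and is cancelled at the end; the other
    -- factor stays as the `1/k` of the formula, whose `k` is `suc k` here.
    scale : ℕ → ℕ → ℚ
    scale n k = ι (suc n) ℚ.* (+ 1 ℚ./ suc k)

    term≡summand : ∀ n k i → suc k ≤ i → i ≤ n ℕ./ m →
      term n (suc k) i ≡ scale n k ℚ.* summand n (suc k) i
    term≡summand n k i k<i i≤n/m = begin
      term n (suc k) i                                     ≡⟨ term-≤ n (suc k) i mi≤n ⟩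
      s ℚ.* ι E                                            ≡⟨ cong (s ℚ.*_) multinomial-identity ⟨
      s ℚ.* (ι (suc n) ℚ.* ((+ 1 ℚ./ suc k) ℚ.* M))        ≡⟨ cong (s ℚ.*_) (ℚ.*-assoc (ι (suc n)) (+ 1 ℚ./ suc k) M) ⟨
      s ℚ.* (scale n k ℚ.* M)        ≡⟨ x∙yz≈y∙xz s (scale n k) M ⟩
      scale n k ℚ.* (s ℚ.* M)        ∎
      where
      open ≡-Reasoning
      open Algebra.Properties.CommutativeSemigroup Q.*-commutativeSemigroup using (x∙yz≈y∙xz)
      mi≤n : m ℕ.* i ≤ n
      mi≤n = ≤n/m⇒m*≤n i≤n/m
      c E : ℕ
      c = n ∸ m ℕ.* i
      E = (suc n C i) ℕ.* ((i C suc k) ℕ.* ((n ℕ.+ c) C n))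
      s M : ℚ
      s = (ℚ.- 1ℚ) ^ℚ (i ∸ suc k)
      M = multinomial (2 ℕ.* n ∸ m ℕ.* i) c ((n ℕ.+ 1) ∸ i) k (i ∸ suc k)
      top : 2 ℕ.* n ∸ m ℕ.* i ≡ n ℕ.+ c
      -- Subtraction is truncated, so regrouping `2n − m i` as `n + (n − m i)` relies on `m i ≤ n`.
      top = trans (cong (λ z → n ℕ.+ z ∸ m ℕ.* i) (ℕ.+-identityʳ n)) (ℕ.+-∸-assoc n mi≤n)
      i≤1+n : i ≤ suc n
      i≤1+n = ℕ.≤-trans i≤n/m (ℕ.≤-trans (ℕ.m/n≤m n m) (ℕ.n≤1+n n))
      instance
        nonZero : NonZero (c ! ℕ.* (suc n ∸ i) ! ℕ.* (k ! ℕ.* (i ∸ suc k) !))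
        nonZero = ℕ.m*n≢0 _ _ {{c ℕ.!* (suc n ∸ i) !≢0}} {{k ℕ.!* (i ∸ suc k) !≢0}}
      multinomial-identity : ι (suc n) ℚ.* ((+ 1 ℚ./ suc k) ℚ.* M) ≡ ι E
      multinomial-identity = trans
        (cong₂ (λ a d → ι (suc n) ℚ.* ((+ 1 ℚ./ suc k) ℚ.* multinomial a c (d ∸ i) k (i ∸ suc k)))
               top (ℕ.+-comm n 1))
        (fraction ((n ℕ.+ c) !) (suc k) (c ! ℕ.* (suc n ∸ i) ! ℕ.* (k ! ℕ.* (i ∸ suc k) !)) (suc n) E
          (term-identity n k i c k<i i≤1+n))

    coefficient : ∀ n k → [t^ n x^ suc k ] (B m) ≡
                  (+ 1 ℚ./ suc k) ℚ.* ∑[ suc k ⋯ n ℕ./ m ] (summand n (suc k))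
    coefficient n k = ι-cancel n (begin
      ι (suc n) ℚ.* coeff (B m n) (suc k)           ≡⟨ ∑-term n (suc k) ⟩
      sumℚ {suc (suc n)} (term n (suc k) ∘ toℕ)
        -- The binomial theorem sums over all `i ≤ n + 1`. Below `k` the power of `X − 1`
        -- contributes nothing, above `n / m` the power of `u` does not.
        ≡⟨ sum-range (suc k) (n ℕ./ m) (suc (suc n)) (term n (suc k))
             (s≤s (ℕ.≤-trans (ℕ.m/n≤m n m) (ℕ.n≤1+n n)))
             (term-low n (suc k)) (λ i i> → term-> n (suc k) i (>n/m⇒m*>n i>)) ⟩
      ∑[ suc k ⋯ n ℕ./ m ] (term n (suc k))
        ≡⟨ sum-cong-range (suc k) (n ℕ./ m) _ _ (term≡summand n k) ⟩
      ∑[ suc k ⋯ n ℕ./ m ] (λ i → scale n k ℚ.* summand n (suc k) i)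
        ≡⟨ *-distribˡ-sum {suc (n ℕ./ m) ∸ suc k} (scale n k) (λ j → summand n (suc k) (suc k ℕ.+ toℕ j)) ⟨
      scale n k ℚ.* ∑[ suc k ⋯ n ℕ./ m ] (summand n (suc k))
        ≡⟨ ℚ.*-assoc (ι (suc n)) (+ 1 ℚ./ suc k) (∑[ suc k ⋯ n ℕ./ m ] (summand n (suc k))) ⟩
      ι (suc n) ℚ.* ((+ 1 ℚ./ suc k) ℚ.* ∑[ suc k ⋯ n ℕ./ m ] (summand n (suc k))) ∎)
      where
      open ≡-Reasoning
      open Algebra.Properties.Semiring.Sum Q.semiring using (*-distribˡ-sum)

open Product using (_×_)

theorem9 :
    ∀ (m : ℕ) .{{_ : NonZero m}} → 2 ≤ m →
    (let open RawRing ℚ[x]⟦t⟧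
         open RingOps ℚ[x]⟦t⟧
     in B m ≈ 1# + (x - 1#) * t ^ m * B m ^ m ÷ (1# - t * B m))
    ×
    (∀ (n k : ℕ) .{{_ : NonZero k}} →
     let open RingOps ℚ-ring
     in [t^ n x^ k ] (B m) ≡
        (+ 1 ℚ./ k) ℚ.* ∑[ k ⋯ n ℕ./ m ] (λ i →
          (ℚ.- ℚ.1ℚ) ^ (i ∸ k) ℚ.*
          multinomial (2 ℕ.* n ∸ m ℕ.* i)
            (n ∸ m ℕ.* i) ((n ℕ.+ 1) ∸ i) (k ∸ 1) (i ∸ k)))
theorem9 (suc (suc p)) _ =
  Weight.functionalEquation (PolynomialRing.polynomialCommutativeRing ℚ.+-*-commutativeRing)
    (suc (suc p)) X {B (suc (suc p))} (Arithmetic.Coefficients.B≈b p) ,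
  λ { n (suc k) → Arithmetic.Coefficients.coefficient p n k }
theorem9 (suc zero) (s≤s ())
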